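{- Let $f:\mathbb{Z}^{+}\to\mathbb{R}^{+}$ and let $n$ be a positive integer such that $\frac{n^2}{4}-nf(n)$ is an integer and $f(n)\le\frac{n}{1000}$. Then $$\gamma(n,f)\ \ge\ \min\left\{\frac{n}{50\sqrt{f(n)}},\ \frac{n^2}{2500f(n)^2},\ \frac{n}{1000}\right\}.$$
   Context: Graphs are finite and simple. A book of size $q$ in a graph is a set of $q$ triangles sharing a common edge. $bk(G)$ denotes the size of the largest book in $G$, i.e. the maximum over edges $e$ of $G$ of the number of triangles of $G$ containing $e$ ($0$ if $G$ has no edges). For a function $f:\mathbb{Z}^{+}\to\mathbb{R}^{+}$, $\gamma(n,f)$ is the minimal value of $bk(G)$ over all graphs $G$ with $n$ vertices and at least $\left\lceil\frac{n^2}{4}-nf(n)\right\rceil$ edges such that every edge of $G$ is contained in at least one triangle. -}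

module Defs where

open import Data.Fin.Base as Fin using (Fin)
import Data.Fin.Properties as Fin
open import Data.Integer.Base as ℤ using (ℤ; +_)
import Data.Integer.Properties as ℤ
open import Data.List.Base using (List; length; filter; map; allFin; cartesianProduct)
open import Data.List.Extrema.Nat using (max)
open import Data.Nat.Base as ℕ using (ℕ; zero; suc)
import Data.Nat.Coprimality as Coprime
import Data.Nat.Properties as ℕ
open import Data.Product.Base using (Σ; ∃; ∃-syntax; _×_; _,_; proj₁; proj₂)
open import Data.Rational.Base
import Data.Rational.Unnormalised.Base as ℚᵘ
import Data.Rational.Unnormalised.Properties as ℚᵘ
open import Data.Rational.Properties
open import Data.Rational.Solver using (module +-*-Solver)
open import Data.Sum.Base using (_⊎_; inj₁; inj₂)
open import Level using (0ℓ)
open import Relation.Binary.Core using (Rel)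
open import Relation.Binary.Definitions using (Decidable; Symmetric; Irreflexive)
open import Relation.Binary.PropositionalEquality
  using (_≡_; refl; sym; trans; cong; cong₂; subst; subst₂)
open import Relation.Nullary.Decidable using (Dec; yes; no; _×-dec_)
open import Relation.Nullary.Negation using (contradiction)

------------------------------------------------------------------------
-- Rational arithmetic

module RationalOrder where
  *-monoˡ-≤ : ∀ {p q} r → 0ℚ ≤ r → p ≤ q → p * r ≤ q * r
  *-monoˡ-≤ r 0≤r = *-monoʳ-≤-nonNeg r {{nonNegative 0≤r}}

  *-monoˡ-< : ∀ {p q} r → 0ℚ < r → p < q → p * r < q * r
  *-monoˡ-< r 0<r = *-monoˡ-<-pos r {{positive 0<r}}

  *-pos : ∀ {p q} → 0ℚ < p → 0ℚ < q → 0ℚ < p * q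
  *-pos {p} {q} 0<p 0<q = subst (_< p * q) (*-zeroˡ q) (*-monoˡ-< q 0<q 0<p)

  *-mono-≤ : ∀ {p q r s} → 0ℚ ≤ r → 0ℚ ≤ q → p ≤ q → r ≤ s → p * r ≤ q * s
  *-mono-≤ {p} {q} {r} {s} 0≤r 0≤q p≤q r≤s = ≤-trans (*-monoˡ-≤ r 0≤r p≤q)
    (*-monoˡ-≤-nonNeg q {{nonNegative 0≤q}} r≤s)

  sq-mono-≤ : ∀ {p q} → 0ℚ ≤ p → p ≤ q → p * p ≤ q * q
  sq-mono-≤ 0≤p p≤q = *-mono-≤ 0≤p (≤-trans 0≤p p≤q) p≤q p≤q

  +-pos : ∀ {p q} → 0ℚ < p → 0ℚ < q → 0ℚ < p + q
  +-pos = +-mono-<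

  0<½ : 0ℚ < ½
  0<½ = positive⁻¹ ½

  0<1 : 0ℚ < 1ℚ
  0<1 = positive⁻¹ 1ℚ

  half-pos : ∀ {ε} → 0ℚ < ε → 0ℚ < ½ * ε
  half-pos = *-pos 0<½

  half+half : ∀ ε → ½ * ε + ½ * ε ≡ ε
  half+half ε = trans (sym (*-distribʳ-+ ε ½ ½)) (*-identityˡ ε)

  p≤p+q : ∀ p {q} → 0ℚ ≤ q → p ≤ p + q
  p≤p+q p {q} 0≤q = subst (_≤ p + q) (+-identityʳ p) (+-monoʳ-≤ p 0≤q)

  p≤∣p∣ : ∀ p → p ≤ ∣ p ∣
  p≤∣p∣ p with ≤-total 0ℚ p
  ... | inj₁ 0≤p = ≤-reflexive (sym (0≤p⇒∣p∣≡p 0≤p))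
  ... | inj₂ p≤0 = ≤-trans p≤0 (0≤∣p∣ p)

  ∣p-q∣≡∣q-p∣ : ∀ p q → ∣ p - q ∣ ≡ ∣ q - p ∣
  ∣p-q∣≡∣q-p∣ p q = trans (cong ∣_∣ (solve 2 (λ p q → p :- q := :- (q :- p)) refl p q))
    (∣-p∣≡∣p∣ (q - p))
    where open +-*-Solver

  q+[p-q]≡p : ∀ p q → q + (p - q) ≡ p
  q+[p-q]≡p = solve 2 (λ p q → q :+ (p :- q) := p) refl
    where open +-*-Solver

  ∣p-q∣<ε⇒p<q+ε : ∀ {p q ε} → ∣ p - q ∣ < ε → p < q + ε
  ∣p-q∣<ε⇒p<q+ε {p} {q} {ε} h = subst (_< q + ε) (q+[p-q]≡p p q)
    (+-monoʳ-< q (≤-<-trans (p≤∣p∣ (p - q)) h))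

  p<q+ε⇒p-q<ε : ∀ {p q ε} → p < q + ε → p - q < ε
  p<q+ε⇒p-q<ε {p} {q} {ε} h = subst (p - q <_)
    (solve 2 (λ q ε → (q :+ ε) :- q := ε) refl q ε) (+-monoˡ-< (- q) h)
    where open +-*-Solver

  ∣p-q∣<ε : ∀ {p q ε} → p < q + ε → q < p + ε → ∣ p - q ∣ < ε
  ∣p-q∣<ε {p} {q} {ε} h₁ h₂ with ∣p∣≡p∨∣p∣≡-p (p - q)
  ... | inj₁ eq = subst (_< ε) (sym eq) (p<q+ε⇒p-q<ε h₁)
  ... | inj₂ eq = subst (_< ε)
    (sym (trans eq (solve 2 (λ p q → :- (p :- q) := q :- p) refl p q))) (p<q+ε⇒p-q<ε h₂)
    where open +-*-Solver

open RationalOrder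

-- The reciprocal, extended by 0 ↦ 0.
inv : ℚ → ℚ
inv   (mkℚ (+ zero)     _ _) = 0ℚ
inv p@(mkℚ ℤ.+[1+ _ ]   _ _) = 1/ p
inv p@(mkℚ ℤ.-[1+ _ ]   _ _) = 1/ p

module Reciprocal where
  inv-inverseʳ : ∀ {p} → 0ℚ < p → p * inv p ≡ 1ℚ
  inv-inverseʳ {mkℚ (+ zero)       _ _} 0<p = contradiction (positive 0<p) λ ()
  inv-inverseʳ {p@(mkℚ ℤ.+[1+ _ ] _ _)} _   = *-inverseʳ p
  inv-inverseʳ {mkℚ ℤ.-[1+ _ ]     _ _} 0<p = contradiction (positive 0<p) λ ()

  *-cancelʳ-< : ∀ {p q} r → 0ℚ ≤ r → p * r < q * r → p < q
  *-cancelʳ-< r 0≤r = *-cancelʳ-<-nonNeg r {{nonNegative 0≤r}}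

  *-cancelʳ-≤ : ∀ {p q} r → 0ℚ < r → p * r ≤ q * r → p ≤ q
  *-cancelʳ-≤ r 0<r = *-cancelʳ-≤-pos r {{positive 0<r}}

  inv-inverseˡ : ∀ {p} → 0ℚ < p → inv p * p ≡ 1ℚ
  inv-inverseˡ {p} 0<p = trans (*-comm (inv p) p) (inv-inverseʳ 0<p)

  inv-< : ∀ {p q} → 0ℚ < p → 1ℚ < q * p → inv p < q
  inv-< {p} {q} 0<p 1<qp = *-cancelʳ-< p (<⇒≤ 0<p)
    (subst (_< q * p) (sym (inv-inverseˡ 0<p)) 1<qp)

  inv-pos : ∀ {p} → 0ℚ < p → 0ℚ < inv p
  inv-pos {p} 0<p = *-cancelʳ-< p (<⇒≤ 0<p)
    (subst₂ _<_ (sym (*-zeroˡ p)) (sym (inv-inverseˡ 0<p)) 0<1)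

open Reciprocal

fromℤ : ℤ → ℚ
fromℤ z = mkℚ z 0 (Coprime.sym (Coprime.1-coprimeTo ℤ.∣ z ∣))

fromℕ : ℕ → ℚ
fromℕ n = fromℤ (+ n)

module FromℤProperties where
  toℚᵘ-fromℤ : ∀ z → toℚᵘ (fromℤ z) ℚᵘ.≃ z ℚᵘ./ 1
  toℚᵘ-fromℤ z = ℚᵘ.≃-refl

  fromℤ-mono-≤ : ∀ {y z} → y ℤ.≤ z → fromℤ y ≤ fromℤ z
  fromℤ-mono-≤ {y} {z} y≤z = toℚᵘ-cancel-≤
    (ℚᵘ.≤-respˡ-≃ (ℚᵘ.≃-sym (toℚᵘ-fromℤ y)) (ℚᵘ.≤-respʳ-≃ (ℚᵘ.≃-sym (toℚᵘ-fromℤ z))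
      (ℚᵘ.*≤* (subst₂ ℤ._≤_ (sym (ℤ.*-identityʳ y)) (sym (ℤ.*-identityʳ z)) y≤z))))

  fromℤ-mono-< : ∀ {y z} → y ℤ.< z → fromℤ y < fromℤ z
  fromℤ-mono-< {y} {z} y<z = toℚᵘ-cancel-<
    (ℚᵘ.<-respˡ-≃ (ℚᵘ.≃-sym (toℚᵘ-fromℤ y)) (ℚᵘ.<-respʳ-≃ (ℚᵘ.≃-sym (toℚᵘ-fromℤ z))
      (ℚᵘ.*<* (subst₂ ℤ._<_ (sym (ℤ.*-identityʳ y)) (sym (ℤ.*-identityʳ z)) y<z))))

  fromℤ-* : ∀ y z → fromℤ (y ℤ.* z) ≡ fromℤ y * fromℤ z
  fromℤ-* y z = toℚᵘ-injective (ℚᵘ.≃-trans (toℚᵘ-fromℤ (y ℤ.* z))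
    (ℚᵘ.≃-trans (ℚᵘ.*≡* refl)
      (ℚᵘ.≃-sym (ℚᵘ.≃-trans (toℚᵘ-homo-* (fromℤ y) (fromℤ z))
        (ℚᵘ.*-cong (toℚᵘ-fromℤ y) (toℚᵘ-fromℤ z))))))

  fromℤ-+ : ∀ y z → fromℤ (y ℤ.+ z) ≡ fromℤ y + fromℤ z
  fromℤ-+ y z = toℚᵘ-injective (ℚᵘ.≃-trans (toℚᵘ-fromℤ (y ℤ.+ z))
    (ℚᵘ.≃-trans (ℚᵘ.*≡* (cong (ℤ._* + 1)
        (sym (cong₂ ℤ._+_ (ℤ.*-identityʳ y) (ℤ.*-identityʳ z)))))
      (ℚᵘ.≃-sym (ℚᵘ.≃-trans (toℚᵘ-homo-+ (fromℤ y) (fromℤ z))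
        (ℚᵘ.+-cong (toℚᵘ-fromℤ y) (toℚᵘ-fromℤ z))))))

  p*↧p≡↥p : ∀ p → p * fromℕ (↧ₙ p) ≡ fromℤ (↥ p)
  p*↧p≡↥p p = toℚᵘ-injective (ℚᵘ.≃-trans (toℚᵘ-homo-* p (fromℕ (↧ₙ p)))
    (ℚᵘ.≃-trans (ℚᵘ.*-cong (ℚᵘ.≃-refl {toℚᵘ p}) (toℚᵘ-fromℤ (↧ p)))
      (ℚᵘ.≃-trans (lemma p) (ℚᵘ.≃-sym (toℚᵘ-fromℤ (↥ p))))))
    where
    lemma : ∀ p → toℚᵘ p ℚᵘ.* (↧ p ℚᵘ./ 1) ℚᵘ.≃ ↥ p ℚᵘ./ 1
    lemma p@record{} = ℚᵘ.*≡* (trans (ℤ.*-identityʳ (↥ p ℤ.* ↧ p))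
      (cong (λ d → ↥ p ℤ.* + d) (sym (ℕ.*-identityʳ (↧ₙ p)))))

  fromℕ-pos : ∀ n .{{_ : ℕ.NonZero n}} → 0ℚ < fromℕ n
  fromℕ-pos (suc n) = fromℤ-mono-< (ℤ.+<+ (ℕ.s≤s ℕ.z≤n))

  fromℕ-nonNeg : ∀ n → 0ℚ ≤ fromℕ n
  fromℕ-nonNeg n = fromℤ-mono-≤ (ℤ.+≤+ ℕ.z≤n)

  fromℕ-* : ∀ m n → fromℕ (m ℕ.* n) ≡ fromℕ m * fromℕ n
  fromℕ-* m n = trans (cong fromℤ (ℤ.pos-* m n)) (fromℤ-* (+ m) (+ n))

  archimedean : ∀ {ε} → 0ℚ < ε → ∃[ N ] ∀ n → N ℕ.≤ n → inv (fromℕ (suc n)) < ε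
  archimedean {ε} 0<ε = ↧ₙ ε , λ n d≤n → inv-< {fromℕ (suc n)} {ε} (fromℕ-pos (suc n))
    (≤-<-trans 1≤εd (*-monoʳ-<-pos ε {{positive 0<ε}}
      (fromℤ-mono-< {+ ↧ₙ ε} {+ suc n} (ℤ.+<+ (ℕ.s≤s d≤n)))))
    where
    1≤↥ : ∀ {p} → 0ℚ < p → + 1 ℤ.≤ ↥ p
    1≤↥ {mkℚ (+ zero)      _ _} 0<p = contradiction (positive 0<p) λ ()
    1≤↥ {mkℚ (+ (suc n))   _ _} _   = ℤ.+≤+ (ℕ.s≤s ℕ.z≤n)
    1≤↥ {mkℚ (ℤ.-[1+ n ]) _ _} 0<p = contradiction (positive 0<p) λ ()
    1≤εd : 1ℚ ≤ ε * fromℕ (↧ₙ ε)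
    1≤εd = subst (1ℚ ≤_) (sym (p*↧p≡↥p ε)) (fromℤ-mono-≤ (1≤↥ 0<ε))

open FromℤProperties

------------------------------------------------------------------------
-- Real numbers, as Cauchy sequences of rationals

Eventually : (ℕ → Set) → Set
Eventually P = ∃[ N ] ∀ n → N ℕ.≤ n → P n

Cauchy : (ℕ → ℚ) → Set
Cauchy x = ∀ ε → 0ℚ < ε → ∃[ N ] ∀ m n → N ℕ.≤ m → N ℕ.≤ n → ∣ x m - x n ∣ < ε

record ℝ : Set where
  constructor mkℝ
  field
    seq    : ℕ → ℚ
    cauchy : Cauchy seq

open ℝ public

infix 4 _≃ᴿ_ _≤ᴿ_ _<ᴿ_

_≃ᴿ_ : Rel ℝ 0ℓ
x ≃ᴿ y = ∀ ε → 0ℚ < ε → Eventually λ n → ∣ seq x n - seq y n ∣ < ε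

_<ᴿ_ : Rel ℝ 0ℓ
x <ᴿ y = ∃[ ε ] 0ℚ < ε × Eventually λ n → seq x n + ε ≤ seq y n

_≤ᴿ_ : Rel ℝ 0ℓ
x ≤ᴿ y = ∀ ε → 0ℚ < ε → Eventually λ n → seq x n ≤ seq y n + ε

module CauchyProperties where
  Close : (ℕ → ℚ) → ℚ → Set
  Close x ε = ∃[ N ] ∀ m n → N ℕ.≤ m → N ℕ.≤ n → x m < x n + ε

  Cauchy₁ : (ℕ → ℚ) → Set
  Cauchy₁ x = ∀ ε → 0ℚ < ε → Close x ε

  cauchy₁ : ∀ x → Cauchy₁ (seq x)
  cauchy₁ x ε 0<ε with cauchy x ε 0<ε
  ... | N , h = N , λ m n N≤m N≤n → ∣p-q∣<ε⇒p<q+ε (h m n N≤m N≤n)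

  fromCauchy₁ : ∀ {x} → Cauchy₁ x → Cauchy x
  fromCauchy₁ c ε 0<ε with c ε 0<ε
  ... | N , h = N , λ m n N≤m N≤n → ∣p-q∣<ε (h m n N≤m N≤n) (h n m N≤n N≤m)

  ⊔ˡ : ∀ {M N n} → M ℕ.⊔ N ℕ.≤ n → M ℕ.≤ n
  ⊔ˡ {M} {N} = ℕ.m⊔n≤o⇒m≤o M N

  ⊔ʳ : ∀ {M N n} → M ℕ.⊔ N ℕ.≤ n → N ℕ.≤ n
  ⊔ʳ {M} {N} = ℕ.m⊔n≤o⇒n≤o M N

  bounded : ∀ x → ∃[ B ] 0ℚ < B × Eventually λ n → ∣ seq x n ∣ ≤ B
  bounded x with cauchy x 1ℚ 0<1
  ... | N , h = 1ℚ + ∣ seq x N ∣ , +-mono-<-≤ 0<1 (0≤∣p∣ (seq x N)) , N , λ n N≤n →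
    subst (λ p → ∣ p ∣ ≤ 1ℚ + ∣ seq x N ∣)
      (trans (+-comm _ (seq x N)) (q+[p-q]≡p (seq x n) (seq x N)))
      (≤-trans (∣p+q∣≤∣p∣+∣q∣ (seq x n - seq x N) (seq x N))
        (+-monoˡ-≤ ∣ seq x N ∣ (<⇒≤ (h n N N≤n ℕ.≤-refl))))

open CauchyProperties

fromℚ : ℚ → ℝ
fromℚ q = mkℝ (λ _ → q) λ ε 0<ε →
  0 , λ _ _ _ _ → subst (_< ε) (cong ∣_∣ (sym (+-inverseʳ q))) 0<ε

0ᴿ : ℝ
0ᴿ = fromℚ 0ℚ

infixl 6 _+ᴿ_ _-ᴿ_
infixl 7 _*ᴿ_ _⊓ᴿ_
infix  8 -ᴿ_

_+ᴿ_ : ℝ → ℝ → ℝ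
seq    (x +ᴿ y) n = seq x n + seq y n
cauchy (x +ᴿ y)   = fromCauchy₁ λ ε 0<ε → go ε (cauchy₁ x (½ * ε) (half-pos 0<ε))
                                               (cauchy₁ y (½ * ε) (half-pos 0<ε))
  where
  open +-*-Solver
  rearrange : ∀ a b ε → (a + ½ * ε) + (b + ½ * ε) ≡ (a + b) + ε
  rearrange a b ε = trans
    (solve 3 (λ a b h → (a :+ h) :+ (b :+ h) := (a :+ b) :+ (h :+ h)) refl a b (½ * ε))
    (cong (λ x → (a + b) + x) (half+half ε))
  go : ∀ ε → Close (seq x) (½ * ε) → Close (seq y) (½ * ε) → Close (λ n → seq x n + seq y n) ε
  go ε (M , h) (N , k) = M ℕ.⊔ N , λ m n a b → subst (seq x m + seq y m <_)
    (rearrange (seq x n) (seq y n) ε)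
    (+-mono-< (h m n (⊔ˡ a) (⊔ˡ b)) (k m n (⊔ʳ {M} a) (⊔ʳ {M} b)))

-ᴿ_ : ℝ → ℝ
seq    (-ᴿ x) n = - seq x n
cauchy (-ᴿ x) ε 0<ε with cauchy x ε 0<ε
... | N , h = N , λ m n a b → subst (_< ε)
  (trans (∣p-q∣≡∣q-p∣ (seq x m) (seq x n))
    (cong ∣_∣ (solve 2 (λ p q → q :- p := (:- p) :- (:- q)) refl (seq x m) (seq x n))))
  (h m n a b)
  where open +-*-Solver

_-ᴿ_ : ℝ → ℝ → ℝ
x -ᴿ y = x +ᴿ (-ᴿ y)

module ProductEstimate where
  *-estimate : ∀ {a b c d A B} ε → 0ℚ < A → 0ℚ < B →
               ∣ a - c ∣ < ε * inv (A + B) → ∣ b - d ∣ < ε * inv (A + B) →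
               ∣ c ∣ ≤ A → ∣ b ∣ ≤ B → ∣ a * b - c * d ∣ < ε
  *-estimate {a} {b} {c} {d} {A} {B} ε 0<A 0<B a-c b-d c≤A b≤B = subst (_< ε) (cong ∣_∣ split)
    (≤-<-trans (∣p+q∣≤∣p∣+∣q∣ ((a - c) * b) ((b - d) * c))
      (subst (∣ (a - c) * b ∣ + ∣ (b - d) * c ∣ <_) total (+-mono-< first second)))
    where
    open +-*-Solver
    η = ε * inv (A + B)
    split : (a - c) * b + (b - d) * c ≡ a * b - c * d
    split = solve 4 (λ a b c d → (a :- c) :* b :+ (b :- d) :* c := a :* b :- c :* d) refl a b c d
    first : ∣ (a - c) * b ∣ < η * B
    first = subst (_< η * B) (sym (∣p*q∣≡∣p∣*∣q∣ (a - c) b))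
      (≤-<-trans (*-monoˡ-≤-nonNeg ∣ a - c ∣ {{∣-∣-nonNeg (a - c)}} b≤B) (*-monoˡ-< B 0<B a-c))
    second : ∣ (b - d) * c ∣ < η * A
    second = subst (_< η * A) (sym (∣p*q∣≡∣p∣*∣q∣ (b - d) c))
      (≤-<-trans (*-monoˡ-≤-nonNeg ∣ b - d ∣ {{∣-∣-nonNeg (b - d)}} c≤A) (*-monoˡ-< A 0<A b-d))
    total : η * B + η * A ≡ ε
    total = trans
      (solve 4 (λ ε i A B → ε :* i :* B :+ ε :* i :* A := ε :* ((A :+ B) :* i)) refl ε (inv (A + B)) A B)
      (trans (cong (ε *_) (inv-inverseʳ (+-pos 0<A 0<B))) (*-identityʳ ε))

open ProductEstimate

_*ᴿ_ : ℝ → ℝ → ℝ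
seq    (x *ᴿ y) n = seq x n * seq y n
cauchy (x *ᴿ y) ε 0<ε = go (bounded x) (bounded y)
  where
  go : (∃[ A ] 0ℚ < A × Eventually λ n → ∣ seq x n ∣ ≤ A) →
       (∃[ B ] 0ℚ < B × Eventually λ n → ∣ seq y n ∣ ≤ B) →
       ∃[ N ] ∀ m n → N ℕ.≤ m → N ℕ.≤ n → ∣ seq x m * seq y m - seq x n * seq y n ∣ < ε
  go (A , 0<A , K , bx) (B , 0<B , L , by) = go′ (cauchy x η 0<η) (cauchy y η 0<η)
    where
    η = ε * inv (A + B)
    0<η : 0ℚ < η
    0<η = *-pos 0<ε (inv-pos (+-pos 0<A 0<B))
    go′ : (∃[ N ] ∀ m n → N ℕ.≤ m → N ℕ.≤ n → ∣ seq x m - seq x n ∣ < η) →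
          (∃[ N ] ∀ m n → N ℕ.≤ m → N ℕ.≤ n → ∣ seq y m - seq y n ∣ < η) →
          ∃[ N ] ∀ m n → N ℕ.≤ m → N ℕ.≤ n → ∣ seq x m * seq y m - seq x n * seq y n ∣ < ε
    go′ (M , cx) (N , cy) = (K ℕ.⊔ L) ℕ.⊔ (M ℕ.⊔ N) , λ m n m≥ n≥ →
      *-estimate {seq x m} {seq y m} {seq x n} {seq y n} {A} {B} ε 0<A 0<B
        (cx m n (⊔ˡ (⊔ʳ {K ℕ.⊔ L} m≥)) (⊔ˡ (⊔ʳ {K ℕ.⊔ L} n≥)))
        (cy m n (⊔ʳ {M} (⊔ʳ {K ℕ.⊔ L} m≥)) (⊔ʳ {M} (⊔ʳ {K ℕ.⊔ L} n≥)))
        (bx n (⊔ˡ (⊔ˡ {K ℕ.⊔ L} n≥)))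
        (by m (⊔ʳ {K} (⊔ˡ {K ℕ.⊔ L} m≥)))

_⊓ᴿ_ : ℝ → ℝ → ℝ
seq    (x ⊓ᴿ y) n = seq x n ⊓ seq y n
cauchy (x ⊓ᴿ y) = fromCauchy₁ λ ε 0<ε → go ε (cauchy₁ x ε 0<ε) (cauchy₁ y ε 0<ε)
  where
  ⊓-mono : ∀ a b c d ε → a < c + ε → b < d + ε → a ⊓ b < c ⊓ d + ε
  ⊓-mono a b c d ε h k with ⊓-sel c d
  ... | inj₁ eq = subst (λ e → a ⊓ b < e + ε) (sym eq) (≤-<-trans (p⊓q≤p a b) h)
  ... | inj₂ eq = subst (λ e → a ⊓ b < e + ε) (sym eq) (≤-<-trans (p⊓q≤q a b) k)
  go : ∀ ε → Close (seq x) ε → Close (seq y) ε → Close (λ n → seq x n ⊓ seq y n) ε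
  go ε (M , h) (N , k) = M ℕ.⊔ N , λ m n a b →
    ⊓-mono (seq x m) (seq y m) (seq x n) (seq y n) ε
      (h m n (⊔ˡ a) (⊔ˡ b)) (k m n (⊔ʳ {M} a) (⊔ʳ {M} b))

------------------------------------------------------------------------
-- Positive reals

record ℝ⁺ : Set where
  constructor mkℝ⁺
  field
    value   : ℝ
    0<value : 0ᴿ <ᴿ value

open ℝ⁺ public using (value)

module Positivity where
  Away : (ℕ → ℚ) → Set
  Away x = ∃[ δ ] 0ℚ < δ × Eventually λ n → δ ≤ x n

  away : (x : ℝ⁺) → Away (seq (value x))
  away (mkℝ⁺ x (δ , 0<δ , N , h)) =
    δ , 0<δ , N , λ n N≤n → subst (_≤ seq x n) (+-identityˡ δ) (h n N≤n)

  mkPos : ∀ x → Away (seq x) → 0ᴿ <ᴿ x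
  mkPos x (δ , 0<δ , N , h) =
    δ , 0<δ , N , λ n N≤n → subst (_≤ seq x n) (sym (+-identityˡ δ)) (h n N≤n)

open Positivity

fromℕ⁺ : (n : ℕ) .{{_ : ℕ.NonZero n}} → ℝ⁺
fromℕ⁺ n = mkℝ⁺ (fromℚ (fromℕ n))
  (mkPos (fromℚ (fromℕ n)) (fromℕ n , fromℕ-pos n , 0 , λ _ _ → ≤-refl))

infixl 7 _*⁺_ _/⁺_

_*⁺_ : ℝ⁺ → ℝ⁺ → ℝ⁺
x *⁺ y = mkℝ⁺ (value x *ᴿ value y) (mkPos (value x *ᴿ value y) (go (away x) (away y)))
  where
  go : Away (seq (value x)) → Away (seq (value y)) → Away (seq (value x *ᴿ value y))
  go (γ , 0<γ , M , h) (δ , 0<δ , N , k) = γ * δ , *-pos 0<γ 0<δ , M ℕ.⊔ N , λ n a →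
    *-mono-≤ (<⇒≤ 0<δ) (≤-trans (<⇒≤ 0<γ) (h n (⊔ˡ a))) (h n (⊔ˡ a)) (k n (⊔ʳ {M} a))

module ReciprocalEstimates where
  cancel-inv : ∀ {p} q → 0ℚ < p → (p * inv p) * q ≡ q
  cancel-inv q 0<p = trans (cong (_* q) (inv-inverseʳ 0<p)) (*-identityˡ q)

  inv-mono : ∀ {p q} → 0ℚ < p → p ≤ q → inv q ≤ inv p
  inv-mono {p} {q} 0<p p≤q = subst₂ _≤_ left right
    (*-monoˡ-≤ (inv p * inv q) (<⇒≤ (*-pos (inv-pos 0<p) (inv-pos 0<q))) p≤q)
    where
    0<q : 0ℚ < q
    0<q = <-≤-trans 0<p p≤q
    left : p * (inv p * inv q) ≡ inv q
    left = trans (sym (*-assoc p (inv p) (inv q))) (cancel-inv (inv q) 0<p)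
    right : q * (inv p * inv q) ≡ inv p
    right = trans (cong (q *_) (*-comm (inv p) (inv q)))
      (trans (sym (*-assoc q (inv q) (inv p))) (cancel-inv (inv p) 0<q))

  inv-lipschitz : ∀ {a b δ} ε → 0ℚ < δ → 0ℚ < ε → δ ≤ a → δ ≤ b →
                  b < a + ε * (δ * δ) → inv a < inv b + ε
  inv-lipschitz {a} {b} {δ} ε 0<δ 0<ε δ≤a δ≤b h = subst₂ _<_ left right
    (*-monoˡ-< (inv a * inv b) (*-pos (inv-pos 0<a) (inv-pos 0<b)) b<)
    where
    open +-*-Solver
    0<a : 0ℚ < a
    0<a = <-≤-trans 0<δ δ≤a
    0<b : 0ℚ < b
    0<b = <-≤-trans 0<δ δ≤b
    b< : b < a + ε * (a * b)
    b< = <-≤-trans h (+-monoʳ-≤ a (*-monoˡ-≤-nonNeg ε {{nonNegative (<⇒≤ 0<ε)}}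
      (*-mono-≤ (<⇒≤ 0<δ) (<⇒≤ 0<a) δ≤a δ≤b)))
    left : b * (inv a * inv b) ≡ inv a
    left = trans (cong (b *_) (*-comm (inv a) (inv b)))
      (trans (sym (*-assoc b (inv b) (inv a))) (cancel-inv (inv a) 0<b))
    expand : ∀ a b i j ε → (a + ε * (a * b)) * (i * j) ≡ (a * i) * j + (a * i) * ((b * j) * ε)
    expand = solve 5 (λ a b i j ε →
      (a :+ ε :* (a :* b)) :* (i :* j) := (a :* i) :* j :+ (a :* i) :* ((b :* j) :* ε)) refl
    right : (a + ε * (a * b)) * (inv a * inv b) ≡ inv b + ε
    right = trans (expand a b (inv a) (inv b) ε)
      (cong₂ _+_ (cancel-inv (inv b) 0<a) (trans (cancel-inv ((b * inv b) * ε) 0<a) (cancel-inv ε 0<b)))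

open ReciprocalEstimates

_⁻¹ : ℝ⁺ → ℝ⁺
x ⁻¹ = mkℝ⁺ y (mkPos y (y-away (away x) (bounded (value x))))
  where
  x̂ : ℕ → ℚ
  x̂ = seq (value x)
  y-close : ∀ ε → 0ℚ < ε → Away x̂ → Close (λ n → inv (x̂ n)) ε
  y-close ε 0<ε (δ , 0<δ , M , h) = go (cauchy₁ (value x) η (*-pos 0<ε (*-pos 0<δ 0<δ)))
    where
    η = ε * (δ * δ)
    go : Close x̂ η → Close (λ n → inv (x̂ n)) ε
    go (N , k) = M ℕ.⊔ N , λ m n a b →
      inv-lipschitz {x̂ m} {x̂ n} {δ} ε 0<δ 0<ε (h m (⊔ˡ a)) (h n (⊔ˡ b))
        (k n m (⊔ʳ {M} b) (⊔ʳ {M} a))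
  y : ℝ
  seq    y n = inv (x̂ n)
  cauchy y   = fromCauchy₁ λ ε 0<ε → y-close ε 0<ε (away x)
  y-away : Away x̂ → (∃[ B ] 0ℚ < B × Eventually λ n → ∣ x̂ n ∣ ≤ B) → Away (seq y)
  y-away (δ , 0<δ , M , h) (B , 0<B , N , k) = inv B , inv-pos 0<B , M ℕ.⊔ N , λ n a →
    inv-mono {x̂ n} {B} (<-≤-trans 0<δ (h n (⊔ˡ a))) (≤-trans (p≤∣p∣ (x̂ n)) (k n (⊔ʳ {M} a)))

_/⁺_ : ℝ⁺ → ℝ⁺ → ℝ⁺
x /⁺ y = x *⁺ (y ⁻¹)

------------------------------------------------------------------------
-- Square roots

isqrt : ℕ → ℕ
isqrt zero    = zero
isqrt (suc n) with suc (isqrt n) ℕ.* suc (isqrt n) ℕ.≤? suc n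
... | yes _ = suc (isqrt n)
... | no  _ = isqrt n

module IsqrtProperties where
  isqrt-lower : ∀ n → isqrt n ℕ.* isqrt n ℕ.≤ n
  isqrt-lower zero    = ℕ.z≤n
  isqrt-lower (suc n) with suc (isqrt n) ℕ.* suc (isqrt n) ℕ.≤? suc n
  ... | yes p = p
  ... | no  _ = ℕ.m≤n⇒m≤1+n (isqrt-lower n)

  isqrt-upper : ∀ n → n ℕ.< suc (isqrt n) ℕ.* suc (isqrt n)
  isqrt-upper zero    = ℕ.s≤s ℕ.z≤n
  isqrt-upper (suc n) with suc (isqrt n) ℕ.* suc (isqrt n) ℕ.≤? suc n
  ... | yes _ = ℕ.≤-<-trans (isqrt-upper n)
                  (ℕ.*-mono-< (ℕ.n<1+n (suc (isqrt n))) (ℕ.n<1+n (suc (isqrt n))))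
  ... | no ¬p = ℕ.≰⇒> ¬p

open IsqrtProperties

-- For p = a/d ≥ 0, the fraction r/(dK) with r² ≤ adK² < (r+1)², where K = k + 1;
-- it satisfies r/(dK) ≤ √p < r/(dK) + 1/K.
√ℚ : ℚ → ℕ → ℚ
√ℚ p k = fromℕ (isqrt (ℤ.∣ ↥ p ∣ ℕ.* d ℕ.* (suc k ℕ.* suc k))) * inv (fromℕ (d ℕ.* suc k))
  where d = ↧ₙ p

module SquareRootEstimates where
  module √ℚ-properties (p : ℚ) (0≤p : 0ℚ ≤ p) (k : ℕ) where
    open +-*-Solver

    d a K r s : ℕ
    d = ↧ₙ p
    a = ℤ.∣ ↥ p ∣
    K = suc k
    s = a ℕ.* d ℕ.* (K ℕ.* K)
    r = isqrt s

    instance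
      dK≢0 : ℕ.NonZero (d ℕ.* K)
      dK≢0 = ℕ.m*n≢0 d K

    D u t : ℚ
    D = fromℕ (d ℕ.* K)
    t = √ℚ p k
    u = inv (fromℕ K)

    0<D : 0ℚ < D
    0<D = fromℕ-pos (d ℕ.* K)

    t*D : t * D ≡ fromℕ r
    t*D = trans (solve 3 (λ r i D → r :* i :* D := r :* (D :* i)) refl (fromℕ r) (inv D) D)
      (trans (cong (fromℕ r *_) (inv-inverseʳ 0<D)) (*-identityʳ (fromℕ r)))

    0≤t : 0ℚ ≤ t
    0≤t = subst (_≤ t) (*-zeroˡ (inv D)) (*-monoˡ-≤ (inv D) (<⇒≤ (inv-pos 0<D)) (fromℕ-nonNeg r))

    p*d : p * fromℕ d ≡ fromℕ a
    p*d = trans (p*↧p≡↥p p) (cong fromℤ (sym (nonneg p (nonNegative 0≤p))))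
      where
      nonneg : ∀ p → NonNegative p → + ℤ.∣ ↥ p ∣ ≡ ↥ p
      nonneg (mkℚ (+ n)        _ _) _ = refl
      nonneg (mkℚ (ℤ.-[1+ n ]) _ _) ()

    p*D² : p * (D * D) ≡ fromℕ s
    p*D² = trans (cong (λ x → p * (x * x)) (fromℕ-* d K))
      (trans (solve 3 (λ p d K → p :* ((d :* K) :* (d :* K)) := ((p :* d) :* d) :* (K :* K))
                refl p (fromℕ d) (fromℕ K))
        (trans (cong (λ x → (x * fromℕ d) * (fromℕ K * fromℕ K)) p*d)
          (sym (trans (fromℕ-* (a ℕ.* d) (K ℕ.* K)) (cong₂ _*_ (fromℕ-* a d) (fromℕ-* K K))))))

    lower : t * t ≤ p
    lower = *-cancelʳ-≤ (D * D) (*-pos 0<D 0<D) (subst₂ _≤_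
      (trans (fromℕ-* r r) (trans (cong₂ _*_ (sym t*D) (sym t*D))
        (solve 2 (λ t D → (t :* D) :* (t :* D) := (t :* t) :* (D :* D)) refl t D)))
      (sym p*D²)
      (fromℤ-mono-≤ (ℤ.+≤+ (isqrt-lower s))))

    1≤u*D : 1ℚ ≤ u * D
    1≤u*D = subst (1ℚ ≤_)
      (sym (trans (cong (u *_) (fromℕ-* d K))
        (trans (solve 3 (λ i d K → i :* (d :* K) := d :* (K :* i)) refl u (fromℕ d) (fromℕ K))
          (trans (cong (fromℕ d *_) (inv-inverseʳ (fromℕ-pos K))) (*-identityʳ (fromℕ d))))))
      (fromℤ-mono-≤ (ℤ.+≤+ (ℕ.s≤s ℕ.z≤n)))

    upper : p < (t + u) * (t + u)
    upper = *-cancelʳ-< (D * D) (<⇒≤ (*-pos 0<D 0<D)) (<-≤-trans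
      (subst₂ _<_ (sym p*D²)
        (trans (fromℕ-* (suc r) (suc r)) (cong₂ _*_ suc-r suc-r))
        (fromℤ-mono-< (ℤ.+<+ (isqrt-upper s))))
      (subst ((t * D + 1ℚ) * (t * D + 1ℚ) ≤_)
        (solve 3 (λ t u D → (t :* D :+ u :* D) :* (t :* D :+ u :* D)
                          := ((t :+ u) :* (t :+ u)) :* (D :* D)) refl t u D)
        (sq-mono-≤ 0≤tD+1 (+-monoʳ-≤ (t * D) 1≤u*D))))
      where
      suc-r : fromℕ (suc r) ≡ t * D + 1ℚ
      suc-r = trans (cong fromℕ (ℕ.+-comm 1 r))
        (trans (fromℤ-+ (+ r) (+ 1)) (cong (_+ 1ℚ) (sym t*D)))
      0≤tD+1 : 0ℚ ≤ t * D + 1ℚ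
      0≤tD+1 = subst (0ℚ ≤_) suc-r (fromℕ-nonNeg (suc r))

  sq-cancel-< : ∀ {p q} → 0ℚ ≤ q → p * p < q * q → p < q
  sq-cancel-< {p} {q} 0≤q h = ≰⇒> λ q≤p → <-irrefl refl (<-≤-trans h (sq-mono-≤ 0≤q q≤p))

  √-modulus : ∀ {a b s t u} h → 0ℚ < h → 0ℚ ≤ t → u < h →
              s * s ≤ a → 0ℚ ≤ t + u → b < (t + u) * (t + u) → a < b + h * h → s < t + (h + h)
  √-modulus {a} {b} {s} {t} {u} h 0<h 0≤t u<h s²≤a 0≤t+u b< a< =
    sq-cancel-< (≤-trans 0≤t (p≤p+q t (<⇒≤ (+-pos 0<h 0<h))))
      (≤-<-trans s²≤a (<-trans a< (<-≤-trans (+-monoˡ-< (h * h) b<)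
        (≤-trans (+-monoˡ-≤ (h * h) (sq-mono-≤ 0≤t+u (+-monoʳ-≤ t (<⇒≤ u<h))))
          (subst ((t + h) * (t + h) + h * h ≤_)
            (solve 2 (λ t h → (t :+ h) :* (t :+ h) :+ h :* h :+ ((t :+ h) :* h :+ (t :+ h) :* h)
                            := (t :+ (h :+ h)) :* (t :+ (h :+ h))) refl t h)
            (p≤p+q _ (+-mono-≤ 0≤th 0≤th)))))))
    where
    open +-*-Solver
    0≤th : 0ℚ ≤ (t + h) * h
    0≤th = subst (_≤ (t + h) * h) (*-zeroˡ h)
      (*-monoˡ-≤ h (<⇒≤ 0<h) (≤-trans 0≤t (p≤p+q t (<⇒≤ 0<h))))

open SquareRootEstimates

√ : ℝ⁺ → ℝ⁺
√ x = mkℝ⁺ y (mkPos y (y-away (away x)))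
  where
  open √ℚ-properties using (0≤t; lower; upper)
  x̂ t u : ℕ → ℚ
  x̂ = seq (value x)
  t n = √ℚ (x̂ n) n
  u n = inv (fromℕ (suc n))
  0≤t+u : ∀ n → 0ℚ ≤ x̂ n → 0ℚ ≤ t n + u n
  0≤t+u n 0≤x = ≤-trans (0≤t (x̂ n) 0≤x n) (p≤p+q (t n) (<⇒≤ (inv-pos (fromℕ-pos (suc n)))))
  t-close : ∀ h → 0ℚ < h → Away x̂ → Close x̂ (h * h) →
            (∃[ N ] ∀ n → N ℕ.≤ n → u n < h) → Close t (h + h)
  t-close h 0<h (δ , 0<δ , L , l) (M , c) (N , v) = L ℕ.⊔ (M ℕ.⊔ N) , λ m n a b →
    √-modulus {x̂ m} {x̂ n} {t m} {t n} {u n} h 0<h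
      (0≤t (x̂ n) (0≤x n b) n) (v n (⊔ʳ {M} (⊔ʳ {L} b)))
      (lower (x̂ m) (0≤x m a) m) (0≤t+u n (0≤x n b)) (upper (x̂ n) (0≤x n b) n)
      (c m n (⊔ˡ (⊔ʳ {L} a)) (⊔ˡ (⊔ʳ {L} b)))
    where
    0≤x : ∀ n → L ℕ.⊔ (M ℕ.⊔ N) ℕ.≤ n → 0ℚ ≤ x̂ n
    0≤x n a = ≤-trans (<⇒≤ 0<δ) (l n (⊔ˡ a))
  y : ℝ
  seq    y   = t
  cauchy y   = fromCauchy₁ λ ε 0<ε → subst (Close t) (half+half ε)
    (t-close (½ * ε) (half-pos 0<ε) (away x)
      (cauchy₁ (value x) (½ * ε * (½ * ε)) (*-pos (half-pos 0<ε) (half-pos 0<ε)))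
      (archimedean (half-pos 0<ε)))
  y-away : Away x̂ → Away t
  y-away (δ , 0<δ , L , l) = go (archimedean (half-pos 0<η))
    where
    η : ℚ
    η = δ ⊓ 1ℚ
    0<η : 0ℚ < η
    0<η with ⊓-sel δ 1ℚ
    ... | inj₁ eq = subst (0ℚ <_) (sym eq) 0<δ
    ... | inj₂ eq = subst (0ℚ <_) (sym eq) 0<1
    η²≤δ : η * η ≤ δ
    η²≤δ = subst (η * η ≤_) (*-identityʳ δ)
      (*-mono-≤ (<⇒≤ 0<η) (<⇒≤ 0<δ) (p⊓q≤p δ 1ℚ) (p⊓q≤q δ 1ℚ))
    cancel : ∀ {p q} h → h + h < p + q → q < h → h ≤ p
    cancel h h₁ h₂ = ≮⇒≥ λ p<h → <-irrefl refl (<-trans h₁ (+-mono-< p<h h₂))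
    go : (∃[ N ] ∀ n → N ℕ.≤ n → u n < ½ * η) → Away t
    go (N , v) = ½ * η , half-pos 0<η , L ℕ.⊔ N , λ n a →
      cancel {t n} {u n} (½ * η) (subst (_< t n + u n) (sym (half+half η)) (η< n a)) (v n (⊔ʳ {L} a))
      where
      η< : ∀ n → L ℕ.⊔ N ℕ.≤ n → η < t n + u n
      η< n a = sq-cancel-< (0≤t+u n 0≤x) (≤-<-trans (≤-trans η²≤δ (l n (⊔ˡ a))) (upper (x̂ n) 0≤x n))
        where
        0≤x : 0ℚ ≤ x̂ n
        0≤x = ≤-trans (<⇒≤ 0<δ) (l n (⊔ˡ a))

------------------------------------------------------------------------
-- Integers among the reals

IsInteger : ℝ → Set
IsInteger x = ∃[ z ] x ≃ᴿ fromℚ (fromℤ z)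

-- z = ⌈x⌉.
IsCeiling : ℝ → ℤ → Set
IsCeiling x z = fromℚ (fromℤ (z ℤ.- + 1)) <ᴿ x × x ≤ᴿ fromℚ (fromℤ z)

------------------------------------------------------------------------
-- Finite simple graphs and books

record Graph (n : ℕ) : Set₁ where
  field
    Adj        : Rel (Fin n) 0ℓ
    adj?       : Decidable Adj
    adj-sym    : Symmetric Adj
    adj-irrefl : Irreflexive _≡_ Adj

module _ {n : ℕ} (G : Graph n) where
  open Graph G

  edges : List (Fin n × Fin n)
  edges = filter (λ (u , v) → (u Fin.<? v) ×-dec adj? u v) (cartesianProduct (allFin n) (allFin n))

  -- A triangle containing the edge uv is determined by its third vertex.
  IsTriangle : Fin n → Fin n → Fin n → Set
  IsTriangle u v w = Adj u v × Adj u w × Adj v w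

  isTriangle? : ∀ u v w → Dec (IsTriangle u v w)
  isTriangle? u v w = adj? u v ×-dec (adj? u w ×-dec adj? v w)

  bookSize : Fin n × Fin n → ℕ
  bookSize (u , v) = length (filter (isTriangle? u v) (allFin n))

  bk : ℕ
  bk = max 0 (map bookSize edges)

  EveryEdgeInTriangle : Set
  EveryEdgeInTriangle = ∀ u v → Adj u v → ∃[ w ] IsTriangle u v w

------------------------------------------------------------------------
-- The function γ

edgeThreshold : ((n : ℕ) .{{_ : ℕ.NonZero n}} → ℝ⁺) → (n : ℕ) .{{_ : ℕ.NonZero n}} → ℝ
edgeThreshold f n = fromℚ (+ (n ℕ.* n) / 4) -ᴿ fromℚ (fromℕ n) *ᴿ value (f n)

record Admissible {n} (c : ℤ) (G : Graph n) : Set where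
  field
    enoughEdges : c ℤ.≤ + length (edges G)
    triangles   : EveryEdgeInTriangle G

-- IsGamma f n g says that g = γ(n, f); both c and g are uniquely determined.  This is
-- a relation because the ceiling of a Cauchy real is not computable.
record IsGamma (f : (n : ℕ) .{{_ : ℕ.NonZero n}} → ℝ⁺) (n : ℕ) .{{_ : ℕ.NonZero n}}
               (g : ℕ) : Set₁ where
  field
    c        : ℤ
    ceil     : IsCeiling (edgeThreshold f n) c
    attained : Σ (Graph n) λ G → Admissible c G × bk G ≡ g
    minimal  : (G : Graph n) → Admissible c G → g ℕ.≤ bk G

{-# OPTIONS --safe #-}
module Submission where

-- Write b for bk(G) and m = n² − 4⌈n²/4 − n f(n)⌉ = 4 n f(n).  Let u be a vertex of maximum
-- degree, A its neighbourhood and B the complement.  A vertex of A has at most b neighbours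
-- in A, because they form triangles on the edge to u.  A vertex of B has at most |A|
-- neighbours, so its neighbours in B are no more than the vertices of A that it misses.
-- Hence if M is the number of non-adjacent pairs in A × B, at most M/2 edges lie in B; and since
-- the ends of an edge inside A together miss at least |B| − b vertices of B, few edges lie in
-- A.  Comparing with the number of edges of G gives M ≤ m and |A|, |B| ≥ n/3.
--
-- Every edge between A and B lies in a triangle, which has an edge inside A or B with a
-- heavy end: a vertex missing at least n/7 vertices of the other side.  There are O(m/n) heavy
-- vertices.  So the edge xy either meets a heavy vertex or is covered by a heavy w adjacent to both
-- ends.  If w has at least s = 2m/n + b neighbours on both sides, then x and y both miss
-- 2m/n vertices of the other side, so they belong to sets of at most 2n/7 tail vertices each.
-- Otherwise w covers at most s b edges.  When b is small, this is too few to cover the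
-- edges between A and B, of which there are nearly n²/4.

open import Defs
open import Data.Integer.Base using (+_)
open import Data.Nat.Base using (ℕ; NonZero)
open import Data.Product.Base using (∃-syntax; _×_)
open import Data.Product.Base using (map₂)
open import Data.Rational.Base using (_/_)

-- Finite sums and counting over Boolean predicates.

module FiniteSums where
  import Algebra.Properties.Semiring.Sum
  open import Data.Bool.Base using (Bool; true; false; if_then_else_; not)
  open import Data.Fin.Base using (Fin; zero; suc)
  open import Data.Nat.Base
  open import Data.Nat.Properties
  open import Function.Base using (_∘_)
  open import Relation.Binary.PropositionalEquality
  open import Relation.Nullary.Decidable using (Dec; does; yes; no)
  open import Relation.Nullary.Negation using (¬_)
  private module Sum = Algebra.Properties.Semiring.Sum +-*-semiring

  -- Opaque, so that summands and index ranges can be inferred from sums.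
  opaque
    sum : ∀ {n} → (Fin n → ℕ) → ℕ
    sum = Sum.sum

    sum-zero : (f : Fin 0 → ℕ) → sum f ≡ 0
    sum-zero f = refl

    sum-suc : ∀ {n} (f : Fin (suc n) → ℕ) → sum f ≡ f zero + sum (f ∘ suc)
    sum-suc f = refl

    sum-cong : ∀ {n} {f g : Fin n → ℕ} → (∀ i → f i ≡ g i) → sum f ≡ sum g
    sum-cong = Sum.sum-cong-≗

    sum-+ : ∀ {n} (f g : Fin n → ℕ) → sum (λ i → f i + g i) ≡ sum f + sum g
    sum-+ = Sum.∑-distrib-+

    sum-comm : ∀ {m n} (f : Fin m → Fin n → ℕ) →
               sum (λ i → sum (f i)) ≡ sum λ j → sum λ i → f i j
    sum-comm = Sum.∑-comm

    sum-*ˡ : ∀ {n} k (f : Fin n → ℕ) → k * sum f ≡ sum λ i → k * f i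
    sum-*ˡ = Sum.*-distribˡ-sum

    sum-*ʳ : ∀ {n} k (f : Fin n → ℕ) → sum f * k ≡ sum λ i → f i * k
    sum-*ʳ = Sum.*-distribʳ-sum

    sum-mono : ∀ {n} {f g : Fin n → ℕ} → (∀ i → f i ≤ g i) → sum f ≤ sum g
    sum-mono {zero}  f≤g = z≤n
    sum-mono {suc n} f≤g = +-mono-≤ (f≤g zero) (sum-mono (f≤g ∘ suc))

    term≤sum : ∀ {n} (f : Fin n → ℕ) i → f i ≤ sum f
    term≤sum f zero    = m≤m+n (f zero) _
    term≤sum f (suc i) = ≤-trans (term≤sum (f ∘ suc) i) (m≤n+m _ (f zero))

  ⟦_⟧ : Bool → ℕ
  ⟦ p ⟧ = if p then 1 else 0

  does-true : ∀ {P : Set} (P? : Dec P) → does P? ≡ true → P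
  does-true (yes p) _ = p
  does-true (no _)  ()

  does-false : ∀ {P : Set} (P? : Dec P) → does P? ≡ false → ¬ P
  does-false (yes _) ()
  does-false (no ¬p) _ = ¬p

  sum-one : ∀ n → sum {n} (λ _ → 1) ≡ n
  sum-one zero    = sum-zero _
  sum-one (suc n) = trans (sum-suc _) (cong suc (sum-one n))

  -- Restriction is by a 0/1 weight, so that the laws of `sum` over all of `Fin n` carry over, in
  -- particular the exchange of two sums.
  on : ∀ {n} → (Fin n → Bool) → (Fin n → ℕ) → ℕ
  on P f = sum λ x → ⟦ P x ⟧ * f x

  count : ∀ {n} → (Fin n → Bool) → ℕ
  count P = on P λ _ → 1

  module _ {n : ℕ} (P : Fin n → Bool) where
    on-mono : ∀ {f g} → (∀ x → P x ≡ true → f x ≤ g x) → on P f ≤ on P g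
    on-mono {f} {g} f≤g = sum-mono λ x → go x (P x) refl
      where
      go : ∀ x p → P x ≡ p → ⟦ p ⟧ * f x ≤ ⟦ p ⟧ * g x
      go x true  Px = *-monoʳ-≤ 1 (f≤g x Px)
      go x false _  = z≤n

    on-cong : ∀ {f g} → (∀ x → P x ≡ true → f x ≡ g x) → on P f ≡ on P g
    on-cong f≡g = ≤-antisym (on-mono λ x → ≤-reflexive ∘ f≡g x)
      (on-mono λ x → ≤-reflexive ∘ sym ∘ f≡g x)

    on-+ : ∀ f g → on P (λ x → f x + g x) ≡ on P f + on P g
    on-+ f g = trans (sum-cong λ x → *-distribˡ-+ ⟦ P x ⟧ (f x) (g x)) (sum-+ _ _)

    on-+₃ : ∀ f g h → on P (λ x → f x + g x + h x) ≡ on P f + on P g + on P h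
    on-+₃ f g h = trans (on-+ _ h) (cong (_+ on P h) (on-+ f g))

    on-*ʳ : ∀ f k → on P (λ x → f x * k) ≡ on P f * k
    on-*ʳ f k = trans (sum-cong λ x → sym (*-assoc ⟦ P x ⟧ (f x) k))
      (sym (sum-*ʳ k _))

    on-*ˡ : ∀ k f → on P (λ x → k * f x) ≡ k * on P f
    on-*ˡ k f = trans (sum-cong λ x → cong (⟦ P x ⟧ *_) (*-comm k (f x)))
      (trans (on-*ʳ f k) (*-comm _ k))

    on-const : ∀ k → on P (λ _ → k) ≡ count P * k
    on-const k = trans (sum-cong λ x → cong (⟦ P x ⟧ *_) (sym (*-identityˡ k))) (on-*ʳ _ k)

    on≤sum : ∀ f → on P f ≤ sum f
    on≤sum f = sum-mono λ x → go (P x)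
      where
      go : ∀ p {k} → ⟦ p ⟧ * k ≤ k
      go true  = ≤-reflexive (*-identityˡ _)
      go false = z≤n

    on-complement : ∀ f → on P f + on (not ∘ P) f ≡ sum f
    on-complement f = trans (sym (sum-+ _ _)) (sum-cong λ x → go (P x))
      where
      go : ∀ p {k} → ⟦ p ⟧ * k + ⟦ not p ⟧ * k ≡ k
      go true  {k} = trans (+-identityʳ _) (*-identityˡ k)
      go false {k} = *-identityˡ k

    on-sum : ∀ {m} (f : Fin n → Fin m → ℕ) →
             on P (λ x → sum (f x)) ≡ sum λ y → on P λ x → f x y
    on-sum f = trans (sum-cong λ x → sum-*ˡ ⟦ P x ⟧ (f x)) (sum-comm _)

    -- Markov's inequality: each counted `x` contributes at least `t` to the sum.
    markov : ∀ t f → on P (λ x → ⟦ does (t ≤? f x) ⟧) * t ≤ on P f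
    markov t f = ≤-trans (≤-reflexive (sym (on-*ʳ _ t))) (on-mono λ x _ → go x (t ≤? f x))
      where
      go : ∀ x (d : Dec (t ≤ f x)) → ⟦ does d ⟧ * t ≤ f x
      go x (yes t≤) = ≤-trans (≤-reflexive (*-identityˡ t)) t≤
      go x (no _)   = z≤n

  on-comm : ∀ {m n} (P : Fin m → Bool) (Q : Fin n → Bool) (f : Fin m → Fin n → ℕ) →
            on P (λ x → on Q (f x)) ≡ on Q λ y → on P λ x → f x y
  on-comm P Q f = trans (on-sum P _) (sum-cong λ y → trans
    (sum-cong λ x → rearrange ⟦ P x ⟧ ⟦ Q y ⟧ (f x y)) (sym (sum-*ˡ ⟦ Q y ⟧ _)))
    where
    rearrange : ∀ p q k → p * (q * k) ≡ q * (p * k)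
    rearrange p q k = trans (sym (*-assoc p q k)) (trans (cong (_* k) (*-comm p q)) (*-assoc q p k))

-- Numerical inequalities

module Arithmetic where
  open import Data.Empty using (⊥)
  open import Data.Nat.Base
  open import Data.Nat.Properties
  open import Data.Nat.Tactic.RingSolver using (solve-∀)
  open import Data.Product.Base using (∃-syntax; _,_)
  open import Data.Sum.Base using (inj₁; inj₂)
  open import Relation.Binary.PropositionalEquality
  open import Relation.Nullary.Negation using (contradiction)

  -- X ≤ Y is certified by Y − X = (R − L) + S, stated without subtraction.
  certify : ∀ {L R X Y} S → L ≤ R → X + R + S ≡ Y + L → X ≤ Y
  certify {L} {R} {X} {Y} S L≤R eq = +-cancelʳ-≤ R X Y
    (≤-trans (m≤m+n (X + R) S) (≤-trans (≤-reflexive eq) (+-monoʳ-≤ Y L≤R)))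

  infixr 6 _⊹_
  infixr 7 _·_

  _⊹_ : ∀ {p q r s} → p ≤ q → r ≤ s → p + r ≤ q + s
  _⊹_ = +-mono-≤

  _·_ : ∀ k {p q} → p ≤ q → k * p ≤ k * q
  k · p≤q = *-monoʳ-≤ k p≤q

  -- The two sides differ by the square of `k`, the gap between `a` and `c`.
  am-gm : ∀ a c → 4 * (a * c) ≤ (a + c) * (a + c)
  am-gm a c with ≤-total a c
  ... | inj₁ a≤c with m≤n⇒∃[o]m+o≡n a≤c
  ...   | k , refl = ≤-trans (m≤m+n _ (k * k)) (≤-reflexive (eq a k))
    where
    eq : ∀ a k → 4 * (a * (a + k)) + k * k ≡ (a + (a + k)) * (a + (a + k))
    eq = solve-∀
  am-gm a c | inj₂ c≤a with m≤n⇒∃[o]m+o≡n c≤a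
  ...   | k , refl = ≤-trans (m≤m+n _ (k * k)) (≤-reflexive (eq c k))
    where
    eq : ∀ c k → 4 * ((c + k) * c) + k * k ≡ (c + k + c) * (c + k + c)
    eq = solve-∀

  -- As m ≤ n²/250 and E ≤ n²/1000, the last hypothesis gives ac ≥ 497n²/2000, whereas a > 2c would
  -- force ac < 2n²/9.
  balanced : ∀ a c {n m b E} → a + c ≡ n → 1000 * b ≤ n → 250 * m ≤ n * n → E ≤ n * b →
             n * n ≤ m + 2 * E + 4 * (a * c) → a ≤ 2 * c
  balanced a c {n} {m} {b} {E} refl b≤ m≤ E≤ edges = ≮⇒≥ λ 2c<a → unbalanced (m≤n⇒∃[o]m+o≡n 2c<a)
    where
    product : 497 * (n * n) ≤ 2000 * (a * c)
    product = certify 0 (500 · edges ⊹ 2 · m≤ ⊹ n · b≤ ⊹ 1000 · E≤) (eq n (a * c) m b E)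
      where
      eq : ∀ n p m b E →
        497 * (n * n) + (500 * (m + 2 * E + 4 * p) + (2 * (n * n) + (n * n + 1000 * (n * b)))) + 0
        ≡ 2000 * p + (500 * (n * n) + (2 * (250 * m) + (n * (1000 * b) + 1000 * E)))
      eq = solve-∀
    unbalanced : ∃[ k ] suc (2 * c) + k ≡ a → ⊥
    unbalanced (k , a≡) = n≮n _ (≤-trans (≤-trans (m≤m+n _ _) (≤-reflexive (sym (eq c k))))
      (subst (λ t → 497 * ((t + c) * (t + c)) ≤ 2000 * (t * c)) (sym a≡) product))
      where
      eq : ∀ c k → 497 * ((suc (2 * c) + k + c) * (suc (2 * c) + k + c))
         ≡ suc (2000 * ((suc (2 * c) + k) * c))
           + (473 * (c * c) + 982 * (c * suc k) + 497 * (k * k) + 994 * k + 496)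
      eq = solve-∀

  large-side : ∀ {a c n} → a + c ≡ n → a ≤ 2 * c → n ≤ 3 * c
  large-side {a} {c} refl a≤ = certify 0 a≤ (eq a c)
    where
    eq : ∀ a c → (a + c) + 2 * c + 0 ≡ 3 * c + a
    eq = solve-∀

  -- From c ≥ n/3 and n ≥ 1000b follows (1000/3 - 1)bE ≤ 2bM. The factor `b` cannot be cancelled
  -- when it is 0, but then E ≤ nb already makes `E` vanish.
  few-inside : ∀ {c n b E M} → n ≤ 3 * c → 1000 * b ≤ n → E ≤ n * b →
               E * c ≤ b * M + b * M + b * E → 150 * E ≤ M
  few-inside {n = n} {b = zero} {E} n≤ b≤ E≤ _ =
    subst (λ E → 150 * E ≤ _) (sym (n≤0⇒n≡0 (≤-trans E≤ (≤-reflexive (*-zeroʳ n))))) z≤n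
  few-inside {c} {n} {b@(suc _)} {E} {M} n≤ b≤ E≤ Ec≤ = *-cancelˡ-≤ (6 * b)
    (certify (97 * (b * E)) (3 · Ec≤ ⊹ E · n≤ ⊹ E · b≤) (eq E b c n M))
    where
    eq : ∀ E b c n M →
      6 * b * (150 * E) + (3 * (b * M + b * M + b * E) + (E * (3 * c) + E * n)) + 97 * (b * E)
      ≡ 6 * b * M + (3 * (E * c) + (E * n + E * (1000 * b)))
    eq = solve-∀

  less-missing : ∀ {M m} → 149 * M ≤ 75 * m → M ≤ m
  less-missing {M} {m} M≤ = *-cancelˡ-≤ 149 (≤-trans M≤ (*-monoˡ-≤ m (m≤m+n 75 74)))

  -- As 4ac ≤ n², it follows that 2M ≤ m + 2E ≤ m + M/75.
  few-missing : ∀ {a c n m E M} → a + c ≡ n → 150 * E ≤ M → n * n + 2 * M ≤ m + 2 * E + 4 * (a * c) →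
                149 * M ≤ 75 * m
  few-missing {a} {c} {n} {m} {E} {M} refl E≤ h = certify 0 (75 · h ⊹ 75 · am-gm a c ⊹ E≤)
    (eq (n * n) m (a * c) E M)
    where
    eq : ∀ q m p E M → 149 * M + (75 * (m + 2 * E + 4 * p) + (75 * q + M)) + 0
       ≡ 75 * m + (75 * (q + 2 * M) + (75 * (4 * p) + 150 * E))
    eq = solve-∀

  -- The threshold n/7 for heavy vertices works because 2n/7 + n/1000 < n/3.
  one-heavy : ∀ {n s b p q} → n ≤ 3 * s → 1000 * b ≤ n → s ≤ p + q + b →
              7 * p < n → 7 * q < n → ⊥
  one-heavy {n} {s} {b} {p} {q} n≤ b≤ s≤ p< q< = contradiction
    (certify {X = 6 + 979 * b} {Y = 0} 0 (7 · n≤ ⊹ 21 · s≤ ⊹ b≤ ⊹ 3 · p< ⊹ 3 · q<) (eq n s b p q)) λ ()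
    where
    eq : ∀ n s b p q →
      6 + 979 * b + (7 * (3 * s) + (21 * (p + q + b) + (n + (3 * n + 3 * n)))) + 0
      ≡ 0 + (7 * n + (21 * s + (1000 * b + (3 * suc (7 * p) + 3 * suc (7 * q)))))
    eq = solve-∀

  -- Here n² ≤ 5m + 4X with 5m ≤ n²/50, so that X ≥ 49n²/200.
  many-cross : ∀ {n m E E′ X M} → n * n ≤ m + 2 * E + 2 * E′ + 4 * X → E ≤ M → E′ ≤ M → M ≤ m →
               250 * m ≤ n * n → 6 * (n * n) ≤ 25 * X
  many-cross {n} {m} {E} {E′} {X} {M} h E≤ E′≤ M≤ m≤ = *-cancelˡ-≤ 8
    (certify (n * n) (50 · h ⊹ 100 · E≤ ⊹ 100 · E′≤ ⊹ 200 · M≤ ⊹ m≤) (eq (n * n) m E E′ X M))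
    where
    eq : ∀ q m E E′ X M →
      8 * (6 * q) + (50 * (m + 2 * E + 2 * E′ + 4 * X) + (100 * M + (100 * M + (200 * m + q)))) + q
      ≡ 8 * (25 * X) + (50 * q + (100 * E + (100 * E′ + (200 * M + 250 * m))))
    eq = solve-∀

  -- Cancelling `m` gives s ≤ 75n/298, a little more than n/4.
  few-tail : ∀ {s m n M} .{{_ : NonZero m}} → s * (2 * m) ≤ n * M → 149 * M ≤ 75 * m → 7 * s ≤ 2 * n
  few-tail {s} {m} {n} {M} s≤ M≤ = *-cancelˡ-≤ (298 * m) {{m*n≢0 298 m}}
    (certify (71 * (m * n)) (1043 · s≤ ⊹ (7 * n) · M≤) (eq s m n M))
    where
    eq : ∀ s m n M → 298 * m * (7 * s) + (1043 * (n * M) + 7 * n * (75 * m)) + 71 * (m * n)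
       ≡ 298 * m * (2 * n) + (1043 * (s * (2 * m)) + 7 * n * (149 * M))
    eq = solve-∀

  few-tail-pairs : ∀ {s t n} → 7 * s ≤ 2 * n → 7 * t ≤ 2 * n → 12 * (s * t) ≤ n * n
  few-tail-pairs {s} {t} {n} s≤ t≤ = *-cancelˡ-≤ 49
    (certify (n * n) (12 · *-mono-≤ s≤ t≤) (eq s t n))
    where
    eq : ∀ s t n → 49 * (12 * (s * t)) + 12 * (2 * n * (2 * n)) + n * n
                 ≡ 49 * (n * n) + 12 * (7 * s * (7 * t))
    eq = solve-∀

  -- Both `h` and `k` are at most 7M/n, so P ≤ 7M ≤ 7n²/250.
  few-meeting : ∀ {n m M P a c h k} .{{_ : NonZero n}} → a + c ≡ n → P ≡ h * c + a * k →
                h * n ≤ 7 * M → k * n ≤ 7 * M → M ≤ m → 250 * m ≤ n * n → 34 * P ≤ n * n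
  few-meeting {n} {m} {M} {_} {a} {c} {h} {k} refl refl h≤ k≤ M≤ m≤ = *-cancelˡ-≤ n
    (certify (12 * (n * m)) (34 · (c · h≤ ⊹ a · k≤) ⊹ (238 * n) · M≤ ⊹ n · m≤) (eq a c h k m M))
    where
    eq : ∀ a c h k m M → (a + c) * (34 * (h * c + a * k))
          + (34 * (c * (7 * M) + a * (7 * M)) + (238 * (a + c) * m + (a + c) * ((a + c) * (a + c))))
          + 12 * ((a + c) * m)
       ≡ (a + c) * ((a + c) * (a + c))
          + (34 * (c * (h * (a + c)) + a * (k * (a + c))) + (238 * (a + c) * M + (a + c) * (250 * m)))
    eq = solve-∀

  -- Since h ≤ 8m/n, n²T ≤ 16m²b + 8nmb². The last two hypotheses bound these terms by 64n⁴/625 and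
  -- 8n⁴/625, and 72/625 < 2/17.
  few-covered : ∀ {n m b h T M} .{{_ : NonZero n}} →
    h * n ≤ 14 * M → 149 * M ≤ 75 * m → n * T ≤ h * ((2 * m + n * b) * b) →
    625 * (b * b * m) ≤ n * n * n → 625 * (m * m * b) ≤ 4 * (n * n * n * n) →
    17 * T ≤ 2 * (n * n)
  few-covered {n} {m} {b} {h} {T} {M} h≤ M≤ T≤ bb≤ mm≤ = *-cancelˡ-≤ 625
    (certify (26 * (n * n)) (17 · 625T≤) (eq₂ (n * n) T))
    where
    h≤8m : h * n ≤ 8 * m
    h≤8m = *-cancelˡ-≤ 149 (certify (142 * m) (149 · h≤ ⊹ 14 · M≤) (eq₁ (h * n) m M))
      where
      eq₁ : ∀ k m M → 149 * k + (149 * (14 * M) + 14 * (75 * m)) + 142 * m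
                    ≡ 149 * (8 * m) + (149 * k + 14 * (149 * M))
      eq₁ = solve-∀
    q : ℕ
    q = (2 * m + n * b) * b
    nnT≤ : n * (n * T) ≤ 8 * m * q
    nnT≤ = ≤-trans (n · T≤) (≤-trans (≤-reflexive (trans (sym (*-assoc n h q)) (cong (_* q) (*-comm n h))))
      (*-monoˡ-≤ q h≤8m))
    625T≤ : 625 * T ≤ 72 * (n * n)
    625T≤ = *-cancelˡ-≤ (n * n) {{m*n≢0 n n}}
      (certify 0 (625 · nnT≤ ⊹ (8 * n) · bb≤ ⊹ 16 · mm≤) (eq n m b T))
      where
      eq : ∀ n m b T → n * n * (625 * T) + (625 * (8 * m * ((2 * m + n * b) * b))
             + (8 * n * (n * n * n) + 16 * (4 * (n * n * n * n)))) + 0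
         ≡ n * n * (72 * (n * n)) + (625 * (n * (n * T))
             + (8 * n * (625 * (b * b * m)) + 16 * (625 * (m * m * b))))
      eq = solve-∀
    eq₂ : ∀ q T → 625 * (17 * T) + 17 * (72 * q) + 26 * q ≡ 625 * (2 * q) + 17 * (625 * T)
    eq₂ = solve-∀

  -- The three shares sum to 1/34 + 1/12 + 2/17 = 47/204, which is less than 6/25.
  too-few : ∀ {n X P S T} .{{_ : NonZero n}} → 6 * (n * n) ≤ 25 * X → X ≤ P + S + T →
            34 * P ≤ n * n → 12 * S ≤ n * n → 17 * T ≤ 2 * (n * n) → ⊥
  too-few {n} {X} {P} {S} {T} X≥ X≤ P≤ S≤ T≤ = contradiction
    (certify {X = n * n} {Y = 0} (48 * (n * n)) (204 · X≥ ⊹ 5100 · X≤ ⊹ 150 · P≤ ⊹ 425 · S≤ ⊹ 300 · T≤)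
      (eq (n * n) X P S T))
    (<⇒≱ (>-nonZero⁻¹ (n * n) {{m*n≢0 n n}}))
    where
    eq : ∀ q X P S T → q + (204 * (25 * X) + (5100 * (P + S + T)
          + (150 * q + (425 * q + 300 * (2 * q))))) + 48 * q
       ≡ 0 + (204 * (6 * q) + (5100 * X + (150 * (34 * P) + (425 * (12 * S) + 300 * (17 * T)))))
    eq = solve-∀

-- Dense graphs with small books

module DenseGraphs where
  open import Data.Bool.Base using (Bool; true; false; if_then_else_; not; _∧_)
  open import Data.Empty using (⊥; ⊥-elim)
  open import Data.Fin.Base using (Fin; zero; suc)
  open import Data.Nat.Base
  open import Data.Nat.Properties
  open import Data.Nat.Tactic.RingSolver using (solve-∀)
  open import Data.Product.Base using (∃-syntax; _×_; _,_)
  open import Data.Sum.Base using (_⊎_; inj₁; inj₂)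
  open import Function.Base using (_∘_)
  open import Relation.Binary.PropositionalEquality
  open import Relation.Nullary.Decidable using (does; dec-true)
  open import Relation.Nullary.Negation using (contradiction)
  open FiniteSums
  open Arithmetic

  argmax : ∀ {n} .{{_ : NonZero n}} (f : Fin n → ℕ) → ∃[ u ] ∀ x → f x ≤ f u
  argmax {suc zero}    f = zero , λ { zero → ≤-refl }
  argmax {2+ n} f with argmax (f ∘ suc)
  ... | u , max with ≤-total (f (suc u)) (f zero)
  ...   | inj₁ le = zero , λ { zero → ≤-refl ; (suc x) → ≤-trans (max x) le }
  ...   | inj₂ le = suc u , λ { zero → le ; (suc x) → max x }

  -- Degrees, missing neighbours and codegrees.

  module _ {n : ℕ} (e : Fin n → Fin n → Bool) where
    deg miss : (Fin n → Bool) → Fin n → ℕ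
    deg  P x = on P λ y → ⟦ e x y ⟧
    miss P x = on P λ y → ⟦ not (e x y) ⟧

    codeg : Fin n → Fin n → ℕ
    codeg x y = on (e x) λ z → ⟦ e y z ⟧

    deg+miss : ∀ P x → deg P x + miss P x ≡ count P
    deg+miss P x = trans (sym (on-+ P _ _)) (on-cong P λ y _ → go (e x y))
      where
      go : ∀ p → ⟦ p ⟧ + ⟦ not p ⟧ ≡ 1
      go true  = refl
      go false = refl

    -- A neighbour of `x` is either missed by `y` or a common neighbour of both.
    deg≤miss+codeg : ∀ P x y → deg P x ≤ miss P y + codeg x y
    deg≤miss+codeg P x y = ≤-trans (on-mono P λ z _ → go (e x z) (e y z))
      (≤-trans (≤-reflexive (on-+ P _ _)) (+-monoʳ-≤ (miss P y) (on≤sum P _)))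
      where
      go : ∀ p q → ⟦ p ⟧ ≤ ⟦ not q ⟧ + ⟦ p ⟧ * ⟦ q ⟧
      go true  true  = ≤-refl
      go true  false = ≤-refl
      go false _     = z≤n

    count≤miss+miss+codeg : ∀ P x y → count P ≤ miss P x + miss P y + codeg x y
    count≤miss+miss+codeg P x y = subst (_≤ miss P x + miss P y + codeg x y)
      (trans (+-comm (miss P x) (deg P x)) (deg+miss P x))
      (≤-trans (+-monoʳ-≤ (miss P x) (deg≤miss+codeg P x y)) (≤-reflexive (sym (+-assoc (miss P x) _ _))))

  module _ {n : ℕ} (e : Fin n → Fin n → Bool) (e-sym : ∀ x y → e x y ≡ e y x)
           (b : ℕ) (codeg≤b : ∀ x y → e x y ≡ true → codeg e x y ≤ b) where
    private
      V : Set
      V = Fin n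

    deg-comm : ∀ P Q → on P (deg e Q) ≡ on Q (deg e P)
    deg-comm P Q = trans (on-comm P Q _)
      (on-cong Q λ y _ → on-cong P λ x _ → cong ⟦_⟧ (e-sym x y))

    miss-comm : ∀ P Q → on P (miss e Q) ≡ on Q (miss e P)
    miss-comm P Q = trans (on-comm P Q _)
      (on-cong Q λ y _ → on-cong P λ x _ → cong (⟦_⟧ ∘ not) (e-sym x y))

    -- The ends of an edge inside `P` have at most `b` common neighbours, so together they miss at
    -- least |Q| - b vertices of `Q`. In the sum over these edges, the misses of a vertex recur once
    -- for each of its at most `b` neighbours in `P`.
    inside-edges : ∀ P Q → (∀ x → P x ≡ true → deg e P x ≤ b) →
      on P (deg e P) * count Q ≤ b * on P (miss e Q) + b * on P (miss e Q) + b * on P (deg e P)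
    inside-edges P Q deg≤b = begin
      on P d * count Q
        ≡⟨ on-*ʳ P d (count Q) ⟨
      on P (λ x → d x * count Q)
        ≤⟨ on-mono P (λ x _ → row x) ⟩
      on P (λ x → d x * μ x + on P (λ y → ⟦ e x y ⟧ * μ y) + b * d x)
        ≡⟨ on-+₃ P _ _ _ ⟩
      on P (λ x → d x * μ x) + on P (λ x → on P λ y → ⟦ e x y ⟧ * μ y) + on P (λ x → b * d x)
        ≡⟨ cong₂ (λ s t → on P (λ x → d x * μ x) + s + t) second (on-*ˡ P b d) ⟩
      on P (λ x → d x * μ x) + on P (λ x → d x * μ x) + b * on P d
        ≤⟨ +-monoˡ-≤ (b * on P d) (+-mono-≤ first first) ⟩
      b * on P μ + b * on P μ + b * on P d ∎
      where
      open ≤-Reasoning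
      d μ : V → ℕ
      d = deg e P
      μ = miss e Q
      row : ∀ x → d x * count Q ≤ d x * μ x + on P (λ y → ⟦ e x y ⟧ * μ y) + b * d x
      row x = begin
        d x * count Q
          ≡⟨ on-*ʳ P _ (count Q) ⟨
        on P (λ y → ⟦ e x y ⟧ * count Q)
          ≤⟨ on-mono P (λ y _ → entry y (e x y) refl) ⟩
        on P (λ y → ⟦ e x y ⟧ * μ x + ⟦ e x y ⟧ * μ y + b * ⟦ e x y ⟧)
          ≡⟨ on-+₃ P _ _ _ ⟩
        on P (λ y → ⟦ e x y ⟧ * μ x) + on P (λ y → ⟦ e x y ⟧ * μ y) + on P (λ y → b * ⟦ e x y ⟧)
          ≡⟨ cong₂ (λ s t → s + on P (λ y → ⟦ e x y ⟧ * μ y) + t) (on-*ʳ P _ (μ x)) (on-*ˡ P b _) ⟩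
        d x * μ x + on P (λ y → ⟦ e x y ⟧ * μ y) + b * d x ∎
        where
        distribute : ∀ s t u → s + t + u ≡ 1 * s + 1 * t + u * 1
        distribute = solve-∀
        entry : ∀ y p → e x y ≡ p → ⟦ p ⟧ * count Q ≤ ⟦ p ⟧ * μ x + ⟦ p ⟧ * μ y + b * ⟦ p ⟧
        entry y false _  = z≤n
        entry y true  xy = ≤-trans (≤-reflexive (*-identityˡ (count Q))) (≤-trans
          (≤-trans (count≤miss+miss+codeg e Q x y) (+-monoʳ-≤ (μ x + μ y) (codeg≤b x y xy)))
          (≤-reflexive (distribute (μ x) (μ y) b)))
      first : on P (λ x → d x * μ x) ≤ b * on P μ
      first = ≤-trans (on-mono P λ x Px → *-monoˡ-≤ (μ x) (deg≤b x Px)) (≤-reflexive (on-*ˡ P b μ))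
      second : on P (λ x → on P λ y → ⟦ e x y ⟧ * μ y) ≡ on P λ x → d x * μ x
      -- Exchanging the sums gathers the copies of `μ y`, one for each neighbour of `y` in `P`.
      second = trans (on-comm P P _) (on-cong P λ y _ → trans
        (on-cong P λ x _ → cong (λ p → ⟦ p ⟧ * μ y) (e-sym x y)) (on-*ʳ P _ (μ y)))

    triangles : V → V → V → ℕ
    triangles w x y = ⟦ e w x ⟧ * ⟦ e w y ⟧ * ⟦ e x y ⟧

    triangles-swap : ∀ w x y → triangles w x y ≡ triangles w y x
    triangles-swap w x y = cong₂ _*_ (*-comm ⟦ e w x ⟧ ⟦ e w y ⟧) (cong ⟦_⟧ (e-sym x y))

    -- Each neighbour `x` of `w` in `P` spans with `w` an edge that lies in at most `b` triangles.
    triangles≤ : ∀ P Q w → on P (λ x → on Q (triangles w x)) ≤ deg e P w * b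
    triangles≤ P Q w = ≤-trans (on-mono P λ x _ → row x (e w x) refl) (≤-reflexive (on-*ʳ P _ b))
      where
      row : ∀ x p → e w x ≡ p → on Q (λ y → ⟦ p ⟧ * ⟦ e w y ⟧ * ⟦ e x y ⟧) ≤ ⟦ p ⟧ * b
      row x true  wx = ≤-trans (on≤sum Q _) (≤-trans
        (≤-reflexive (sum-cong λ y → cong (_* ⟦ e x y ⟧) (*-identityˡ ⟦ e w y ⟧)))
        (≤-trans (codeg≤b w x wx) (≤-reflexive (sym (*-identityˡ b)))))
      row x false _  = ≤-reflexive (trans (on-const Q 0) (*-zeroʳ (count Q)))

    triangles≤′ : ∀ P Q w → on P (λ x → on Q (triangles w x)) ≤ deg e Q w * b
    triangles≤′ P Q w = ≤-trans (≤-reflexive (trans (on-comm P Q _)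
      (on-cong Q λ y _ → on-cong P λ x _ → triangles-swap w x y))) (triangles≤ Q P w)

    -- The last four inequalities before `u` include the failure of each alternative of
    -- `book-lower-bound`, in weak form; the module derives a contradiction. The double sum in
    -- `many-edges` counts every edge twice.
    module Partition (m : ℕ) .{{_ : NonZero n}} .{{_ : NonZero m}}
      (in-triangle : ∀ x y → e x y ≡ true → ∃[ z ] e x z ≡ true × e y z ≡ true)
      (many-edges : n * n ≤ m + 2 * sum (λ x → sum λ y → ⟦ e x y ⟧))
      (b-small : 1000 * b ≤ n) (m-small : 250 * m ≤ n * n)
      (bbm-small : 625 * (b * b * m) ≤ n * n * n)
      (mmb-small : 625 * (m * m * b) ≤ 4 * (n * n * n * n))
      (u : V) (u-max : ∀ x → sum (λ y → ⟦ e x y ⟧) ≤ sum λ y → ⟦ e u y ⟧) where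

      A B : V → Bool
      A = e u
      B = not ∘ A

      -- `E` and `E′` count each edge inside a side from both of its ends, whereas `X` and `M` count
      -- the adjacent and the non-adjacent pairs of A × B once.
      a c M E E′ X : ℕ
      a  = count A
      c  = count B
      M  = on A (miss e B)
      E  = on A (deg e A)
      E′ = on B (deg e B)
      X  = on A (deg e B)

      a+c≡n : a + c ≡ n
      a+c≡n = trans (on-complement A _) (sum-one n)

      X+M≡ac : X + M ≡ a * c
      X+M≡ac = trans (sym (on-+ A _ _)) (trans (on-cong A λ x _ → deg+miss e B x) (on-const A c))

      edges≤ : n * n ≤ m + 2 * E + 2 * E′ + 4 * X
      edges≤ = ≤-trans many-edges (≤-reflexive (trans (cong (λ s → m + 2 * s) total)
        (trans (cong (λ x → m + 2 * (E + X + (x + E′))) (deg-comm B A)) (rearrange m E X E′))))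
        where
        rearrange : ∀ m E X E′ → m + 2 * (E + X + (X + E′)) ≡ m + 2 * E + 2 * E′ + 4 * X
        rearrange = solve-∀
        total : sum (λ x → sum λ y → ⟦ e x y ⟧) ≡ E + X + (on B (deg e A) + E′)
        total = trans (sum-cong λ x → sym (on-complement A λ y → ⟦ e x y ⟧))
          (trans (sym (on-complement A _)) (cong₂ _+_ (on-+ A _ _) (on-+ B _ _)))

      -- As `A` is the neighbourhood of `u`, `deg e A x` unfolds to `codeg e u x`.
      degA≤b : ∀ x → A x ≡ true → deg e A x ≤ b
      degA≤b x = codeg≤b u x

      -- A vertex of B has at most as many neighbours as u, that is, at most |A|.
      E′≤M : E′ ≤ M
      E′≤M = ≤-trans (on-mono B λ x _ → +-cancelˡ-≤ (deg e A x) _ _ (begin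
          deg e A x + deg e B x      ≡⟨ on-complement A _ ⟩
          sum (λ y → ⟦ e x y ⟧)      ≤⟨ u-max x ⟩
          sum (λ y → ⟦ e u y ⟧)      ≡⟨ sum-cong (λ y → *-identityʳ ⟦ e u y ⟧) ⟨
          a                          ≡⟨ deg+miss e A x ⟨
          deg e A x + miss e A x     ∎)) (≤-reflexive (miss-comm B A))
        where open ≤-Reasoning

      E≤nb : E ≤ n * b
      E≤nb = ≤-trans (on-mono A degA≤b) (≤-trans (≤-reflexive (on-const A b))
        (*-monoˡ-≤ b (≤-trans (m≤m+n a c) (≤-reflexive a+c≡n))))

      -- Bounding `E′` by `M` costs 2M, while replacing `X` by ac - M gains 4M.
      deficit : n * n + 2 * M ≤ m + 2 * E + 4 * (a * c)
      deficit = certify 0 (edges≤ ⊹ 2 · E′≤M)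
        (trans (eq (n * n) M m E E′ X) (cong (λ p → m + 2 * E + 4 * p + (n * n + 2 * E′)) X+M≡ac))
        where
        eq : ∀ q M m E E′ X → q + 2 * M + (m + 2 * E + 2 * E′ + 4 * X + 2 * M) + 0
                            ≡ m + 2 * E + 4 * (X + M) + (q + 2 * E′)
        eq = solve-∀

      n²≤ : n * n ≤ m + 2 * E + 4 * (a * c)
      n²≤ = ≤-trans (m≤m+n (n * n) (2 * M)) deficit

      n≤3c : n ≤ 3 * c
      n≤3c = large-side {a} {c} a+c≡n (balanced a c {n} {m} {b} {E} a+c≡n b-small m-small E≤nb n²≤)

      n≤3a : n ≤ 3 * a
      n≤3a = large-side {c} {a} c+a≡n (balanced c a {n} {m} {b} {E} c+a≡n b-small m-small E≤nb
        (subst (λ p → n * n ≤ m + 2 * E + 4 * p) (*-comm a c) n²≤))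
        where
        c+a≡n : c + a ≡ n
        c+a≡n = trans (+-comm c a) a+c≡n

      150E≤M : 150 * E ≤ M
      150E≤M = few-inside {c} {n} {b} {E} {M} n≤3c b-small E≤nb (inside-edges A B degA≤b)

      149M≤75m : 149 * M ≤ 75 * m
      149M≤75m = few-missing {a} {c} {n} {m} {E} {M} a+c≡n 150E≤M deficit

      M≤m : M ≤ m
      M≤m = less-missing {M} {m} 149M≤75m

      -- The number of vertices on the opposite side that `x` misses; it sums to `M` over either
      -- side.
      h : V → ℕ
      h x = if A x then miss e B x else miss e A x

      h-A : ∀ x → A x ≡ true → h x ≡ miss e B x
      h-A x Ax = cong (if_then miss e B x else miss e A x) Ax

      h-B : ∀ x → B x ≡ true → h x ≡ miss e A x
      h-B x Bx with A x
      ... | false = refl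

      hA≡M : on A h ≡ M
      hA≡M = on-cong A h-A

      hB≡M : on B h ≡ M
      hB≡M = trans (on-cong B h-B) (miss-comm B A)

      -- The thresholds are n/7 and 2m/n for `h`, cleared of division. A vertex is `low` when it has
      -- fewer than 2m/n + b neighbours on at least one side.
      heavy tail low : V → Bool
      heavy x = does (n ≤? 7 * h x)
      tail  x = does (2 * m ≤? n * h x)
      low   w = not (does (2 * m + n * b ≤? n * deg e A w) ∧ does (2 * m + n * b ≤? n * deg e B w))

      few-heavy : ∀ P → on P h ≡ M → on P (⟦_⟧ ∘ heavy) * n ≤ 7 * M
      few-heavy P hP = ≤-trans (markov P n _) (≤-reflexive (trans (on-*ˡ P 7 h) (cong (7 *_) hP)))

      few-tails : ∀ P → on P h ≡ M → 7 * on P (⟦_⟧ ∘ tail) ≤ 2 * n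
      few-tails P hP = few-tail {on P (⟦_⟧ ∘ tail)} {m} {n} {M} (≤-trans (markov P (2 * m) _)
        (≤-reflexive (trans (on-*ˡ P n h) (cong (n *_) hP)))) 149M≤75m

      -- For an edge within one side and `Q` the opposite side, the ends together miss at least |Q|
      -- - b > 2n/7 vertices of `Q`.
      heavy-end : ∀ Q x y → n ≤ 3 * count Q → e x y ≡ true → h x ≡ miss e Q x → h y ≡ miss e Q y →
                  heavy x ≡ true ⊎ heavy y ≡ true
      heavy-end Q x y n≤ xy hx hy = by-cases (heavy x) (heavy y) refl refl
        where
        by-cases : ∀ p q → heavy x ≡ p → heavy y ≡ q → heavy x ≡ true ⊎ heavy y ≡ true
        by-cases true  _     Hx  _   = inj₁ Hx
        by-cases false true  _   Hy  = inj₂ Hy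
        by-cases false false ¬Hx ¬Hy = contradiction (≰⇒> (does-false (_ ≤? _) ¬Hy)) λ y< →
          one-heavy {n} {count Q} {b} {h x} {h y} n≤ b-small
            (subst₂ (λ s t → count Q ≤ s + t + b) (sym hx) (sym hy)
              (≤-trans (count≤miss+miss+codeg e Q x y) (+-monoʳ-≤ _ (codeg≤b x y xy))))
            (≰⇒> (does-false (_ ≤? _) ¬Hx)) y<

      -- At most `b` neighbours of `w` in `Q` are adjacent to `x`, which misses the others, at least
      -- 2m/n of them.
      in-tail : ∀ Q w x → e w x ≡ true → h x ≡ miss e Q x → 2 * m + n * b ≤ n * deg e Q w →
                tail x ≡ true
      in-tail Q w x wx hx q≤ = dec-true (_ ≤? _) (+-cancelʳ-≤ (n * b) _ _ (≤-trans q≤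
        (≤-trans (*-monoʳ-≤ n (≤-trans (deg≤miss+codeg e Q w x) (+-mono-≤ (≤-reflexive (sym hx))
          (codeg≤b w x wx)))) (≤-reflexive (*-distribˡ-+ n (h x) b)))))

      Covered : V → V → Set
      Covered x y = (heavy x ≡ true ⊎ heavy y ≡ true) ⊎ (tail x ≡ true × tail y ≡ true)
                  ⊎ ∃[ w ] heavy w ≡ true × low w ≡ true × e w x ≡ true × e w y ≡ true

      -- The third vertex `z` of a triangle on the edge lies on the side of `x` or of `y`, and the
      -- triangle's edge within that side has a heavy end. If this is `z`, then either `z` is `low`
      -- or both `x` and `y` are in the tail.
      covered : ∀ x y → A x ≡ true → B y ≡ true → e x y ≡ true → Covered x y
      covered x y Ax By xy with in-triangle x y xy
      ... | z , xz , yz = by-side (A z) refl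
        where
        zx : e z x ≡ true
        zx = trans (e-sym z x) xz
        zy : e z y ≡ true
        zy = trans (e-sym z y) yz
        via : heavy z ≡ true → Covered x y
        via Hz = by-cases _ _ refl refl
          where
          by-cases : ∀ p q → does (2 * m + n * b ≤? n * deg e A z) ≡ p →
                     does (2 * m + n * b ≤? n * deg e B z) ≡ q → Covered x y
          -- The sides cross: the neighbours of `z` in `B` force misses of `x`, those in `A` force
          -- misses of `y`.
          by-cases true true pA pB = inj₂ (inj₁ (in-tail B z x zx (h-A x Ax) (does-true (_ ≤? _) pB)
                                               , in-tail A z y zy (h-B y By) (does-true (_ ≤? _) pA)))
          by-cases true false pA pB = inj₂ (inj₂ (z , Hz , cong₂ (λ s t → not (s ∧ t)) pA pB , zx , zy))
          by-cases false _    pA _  = inj₂ (inj₂ (z , Hz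
            , cong (λ s → not (s ∧ does (2 * m + n * b ≤? n * deg e B z))) pA , zx , zy))
        by-side : ∀ p → A z ≡ p → Covered x y
        by-side true Az with heavy-end B x z n≤3c xz (h-A x Ax) (h-A z Az)
        ... | inj₁ Hx = inj₁ (inj₁ Hx)
        ... | inj₂ Hz = via Hz
        by-side false Az with heavy-end A y z n≤3a yz (h-B y By) (h-B z (cong not Az))
        ... | inj₁ Hy = inj₁ (inj₂ Hy)
        ... | inj₂ Hz = via Hz

      -- `Covered` as an inequality between indicators, ready to be summed over A × B.
      covering : ∀ x y → A x ≡ true → B y ≡ true → ⟦ e x y ⟧ ≤
        ⟦ heavy x ⟧ + ⟦ heavy y ⟧ + ⟦ tail x ⟧ * ⟦ tail y ⟧
        + sum (λ w → ⟦ heavy w ⟧ * (⟦ low w ⟧ * triangles w x y))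
      covering x y Ax By = by-cases (e x y) refl
        where
        by-cases : ∀ p → e x y ≡ p → ⟦ p ⟧ ≤ ⟦ heavy x ⟧ + ⟦ heavy y ⟧ + ⟦ tail x ⟧ * ⟦ tail y ⟧
          + sum (λ w → ⟦ heavy w ⟧ * (⟦ low w ⟧ * triangles w x y))
        by-cases false _  = z≤n
        by-cases true  xy with covered x y Ax By xy
        ... | inj₁ (inj₁ Hx) rewrite Hx = s≤s z≤n
        ... | inj₁ (inj₂ Hy) rewrite Hy = ≤-trans (m≤n+m 1 ⟦ heavy x ⟧) (≤-trans (m≤m+n _ _) (m≤m+n _ _))
        ... | inj₂ (inj₁ (Sx , Sy)) rewrite Sx | Sy = ≤-trans (m≤n+m 1 (⟦ heavy x ⟧ + ⟦ heavy y ⟧)) (m≤m+n _ _)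
        ... | inj₂ (inj₂ (w , Hw , lw , wx , wy)) = ≤-trans (≤-reflexive (sym one))
          (≤-trans (term≤sum (λ w → ⟦ heavy w ⟧ * (⟦ low w ⟧ * triangles w x y)) w) (m≤n+m _ _))
          where
          one : ⟦ heavy w ⟧ * (⟦ low w ⟧ * triangles w x y) ≡ 1
          one = trans (cong₂ (λ p q → ⟦ p ⟧ * (⟦ q ⟧ * triangles w x y)) Hw lw)
            (trans (cong₂ (λ p q → 1 * (1 * (⟦ p ⟧ * ⟦ q ⟧ * ⟦ e x y ⟧))) wx wy)
              (cong (λ p → 1 * (1 * (1 * 1 * ⟦ p ⟧))) xy))

      q T : ℕ
      q = 2 * m + n * b
      T = sum λ w → ⟦ heavy w ⟧ * (⟦ low w ⟧ * on A λ x → on B (triangles w x))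

      -- The triangles are counted from the side on which `w` has fewer than q/n neighbours, with at
      -- most `b` for each neighbour.
      low-triangles : ∀ w → n * (⟦ low w ⟧ * on A (λ x → on B (triangles w x))) ≤ q * b
      low-triangles w = by-cases _ _ refl refl
        where
        τ : ℕ
        τ = on A λ x → on B (triangles w x)
        bound : ∀ d → does (q ≤? n * d) ≡ false → τ ≤ d * b → n * (1 * τ) ≤ q * b
        bound d ¬q≤ τ≤ = ≤-trans (*-monoʳ-≤ n (≤-trans (≤-reflexive (*-identityˡ τ)) τ≤))
          (≤-trans (≤-reflexive (sym (*-assoc n d b)))
            (*-monoˡ-≤ b (<⇒≤ (≰⇒> (does-false (q ≤? n * d) ¬q≤)))))
        by-cases : ∀ s t → does (q ≤? n * deg e A w) ≡ s → does (q ≤? n * deg e B w) ≡ t →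
                   n * (⟦ low w ⟧ * τ) ≤ q * b
        by-cases false _ pA _ = subst (λ s → n * (⟦ not (s ∧ does (q ≤? n * deg e B w)) ⟧ * τ) ≤ q * b) (sym pA)
          (bound (deg e A w) pA (triangles≤ A B w))
        by-cases true false pA pB = subst₂ (λ s t → n * (⟦ not (s ∧ t) ⟧ * τ) ≤ q * b) (sym pA) (sym pB)
          (bound (deg e B w) pB (triangles≤′ A B w))
        -- Here `low w` is false and the term vanishes.
        by-cases true true pA pB = subst₂ (λ s t → n * (⟦ not (s ∧ t) ⟧ * τ) ≤ q * b) (sym pA) (sym pB)
          (≤-trans (≤-reflexive (*-zeroʳ n)) z≤n)

      hA hB sA sB : ℕ
      hA = on A (⟦_⟧ ∘ heavy)
      hB = on B (⟦_⟧ ∘ heavy)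
      sA = on A (⟦_⟧ ∘ tail)
      sB = on B (⟦_⟧ ∘ tail)

      nT≤ : n * T ≤ (hA + hB) * (q * b)
      nT≤ = begin
        n * T
          ≡⟨ sum-*ˡ n _ ⟩
        sum (λ w → n * (⟦ heavy w ⟧ * (⟦ low w ⟧ * on A λ x → on B (triangles w x))))
          ≡⟨ sum-cong (λ w → *-left-comm n ⟦ heavy w ⟧ _) ⟩
        on heavy (λ w → n * (⟦ low w ⟧ * on A λ x → on B (triangles w x)))
          ≤⟨ on-mono heavy (λ w _ → low-triangles w) ⟩
        on heavy (λ _ → q * b)
          ≡⟨ on-const heavy (q * b) ⟩
        count heavy * (q * b)
          ≡⟨ cong (_* (q * b)) (trans (on-complement A _) (sum-cong λ w → sym (*-identityʳ ⟦ heavy w ⟧))) ⟨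
        (hA + hB) * (q * b) ∎
        where
        open ≤-Reasoning
        *-left-comm : ∀ i j k → i * (j * k) ≡ j * (i * k)
        *-left-comm = solve-∀

      X≤ : X ≤ (hA * c + a * hB) + sA * sB + T
      X≤ = begin
        X
          ≤⟨ on-mono A (λ x Ax → on-mono B λ y By → covering x y Ax By) ⟩
        on A (λ x → on B λ y → ⟦ heavy x ⟧ + ⟦ heavy y ⟧ + ⟦ tail x ⟧ * ⟦ tail y ⟧
          + sum (λ w → ⟦ heavy w ⟧ * (⟦ low w ⟧ * triangles w x y)))
          ≡⟨ on-cong A (λ x _ → inner x) ⟩
        on A (λ x → (⟦ heavy x ⟧ * c + hB) + ⟦ tail x ⟧ * sB
          + sum (λ w → ⟦ heavy w ⟧ * (⟦ low w ⟧ * on B (triangles w x))))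
          ≡⟨ trans (on-+₃ A _ _ _) (cong₂ _+_ (cong₂ _+_
               (trans (on-+ A _ _) (cong₂ _+_ (on-*ʳ A _ c) (on-const A hB)))
               (on-*ʳ A _ sB)) (pull A _)) ⟩
        (hA * c + a * hB) + sA * sB + T ∎
        where
        open ≤-Reasoning
        pull : ∀ P (f : V → V → ℕ) →
               on P (λ x → sum λ w → ⟦ heavy w ⟧ * (⟦ low w ⟧ * f w x)) ≡
               sum λ w → ⟦ heavy w ⟧ * (⟦ low w ⟧ * on P (f w))
        pull P f = trans (on-sum P _) (sum-cong λ w →
          trans (on-*ˡ P ⟦ heavy w ⟧ _) (cong (⟦ heavy w ⟧ *_) (on-*ˡ P ⟦ low w ⟧ _)))
        inner : ∀ x → on B (λ y → ⟦ heavy x ⟧ + ⟦ heavy y ⟧ + ⟦ tail x ⟧ * ⟦ tail y ⟧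
            + sum (λ w → ⟦ heavy w ⟧ * (⟦ low w ⟧ * triangles w x y)))
          ≡ (⟦ heavy x ⟧ * c + hB) + ⟦ tail x ⟧ * sB
            + sum (λ w → ⟦ heavy w ⟧ * (⟦ low w ⟧ * on B (triangles w x)))
        inner x = trans (on-+₃ B _ _ _) (cong₂ _+_ (cong₂ _+_
          (trans (on-+ B _ _) (cong (_+ hB) (trans (on-const B _) (*-comm c ⟦ heavy x ⟧))))
          (on-*ˡ B ⟦ tail x ⟧ _)) (pull B λ w → triangles w x))

      impossible : ⊥
      impossible = too-few {n} {X} {hA * c + a * hB} {sA * sB} {T}
        (many-cross {n} {m} {E} {E′} {X} {M} edges≤ (≤-trans (m≤m+n E (149 * E)) 150E≤M) E′≤M M≤m m-small) X≤
        (few-meeting {n} {m} {M} {hA * c + a * hB} {a} {c} {hA} {hB} a+c≡n refl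
          (few-heavy A hA≡M) (few-heavy B hB≡M) M≤m m-small)
        (few-tail-pairs {sA} {sB} {n} (few-tails A hA≡M) (few-tails B hB≡M))
        (few-covered {n} {m} {b} {hA + hB} {T} {M} heavy≤ 149M≤75m nT≤ bbm-small mmb-small)
        where
        heavy≤ : (hA + hB) * n ≤ 14 * M
        heavy≤ = ≤-trans (≤-reflexive (*-distribʳ-+ n hA hB)) (≤-trans
          (+-mono-≤ (few-heavy A hA≡M) (few-heavy B hB≡M)) (≤-reflexive (sym (*-distribʳ-+ M 7 7))))

    -- For m = 4nf, the alternatives read b ≥ n/1000, b ≥ n/(50√f) and b ≥ n²/(2500f²).
    book-lower-bound : (m : ℕ) .{{_ : NonZero n}} .{{_ : NonZero m}} →
      (∀ x y → e x y ≡ true → ∃[ z ] e x z ≡ true × e y z ≡ true) →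
      n * n ≤ m + 2 * sum (λ x → sum λ y → ⟦ e x y ⟧) → 250 * m ≤ n * n →
      n ≤ 1000 * b ⊎ n * n * n ≤ 625 * (b * b * m) ⊎ 4 * (n * n * n * n) ≤ 625 * (m * m * b)
    book-lower-bound m in-triangle many-edges m-small
      with ≤-total n (1000 * b) | ≤-total (n * n * n) (625 * (b * b * m))
         | ≤-total (4 * (n * n * n * n)) (625 * (m * m * b)) | argmax (λ x → sum λ y → ⟦ e x y ⟧)
    ... | inj₁ p | _      | _      | _         = inj₁ p
    ... | _      | inj₁ p | _      | _         = inj₂ (inj₁ p)
    ... | _      | _      | inj₁ p | _         = inj₂ (inj₂ p)
    ... | inj₂ p | inj₂ q | inj₂ r | u , u-max = ⊥-elim
      (Partition.impossible m in-triangle many-edges p m-small q r u u-max)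

-- Books, and the existence of γ(n, f)

module Books where
  open import Data.Bool.Base using (Bool; true; false; _∧_; not)
  import Data.Bool.Properties as Bool
  open import Data.Fin.Base as Fin using (Fin; zero; suc; combine; remQuot)
  import Data.Fin.Properties as Fin
  open import Data.Fin.Subset using (Subset)
  open import Data.Fin.Subset.Properties using (anySubset?)
  open import Data.Integer.Base as ℤ using (ℤ)
  import Data.Integer.Properties as ℤ
  open import Data.List.Base using (_++_; length; filter; map; tabulate; allFin; cartesianProduct)
  open import Data.List.Properties using (filter-++; length-++; map-tabulate; filter-≐; map-cong)
  open import Data.List.Extrema.Nat using (max; xs≤max)
  open import Data.List.Membership.Propositional.Properties
    using (∈-filter⁺; ∈-cartesianProduct⁺; ∈-allFin; ∈-map⁺)
  open import Data.List.Relation.Unary.All as All using ()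
  open import Data.Nat.Base
  open import Data.Nat.Properties
  open import Data.Nat.Tactic.RingSolver using (solve-∀)
  open import Data.Product.Base using (Σ; ∃-syntax; _×_; _,_; proj₁; proj₂; map₂)
  open import Data.Sum.Base using (_⊎_; inj₁; inj₂)
  open import Data.Vec.Base as Vec using (lookup)
  open import Data.Vec.Properties using (lookup∘tabulate)
  open import Function.Base using (_∘_)
  open import Function.Bundles using (_⇔_; mk⇔; module Equivalence)
  open import Relation.Binary.Definitions using (tri<; tri≈; tri>)
  open import Relation.Binary.PropositionalEquality
  open import Relation.Nullary.Decidable
    using (Dec; yes; no; does; map′; ¬?; _×-dec_; _→-dec_; does-⇔; dec-true; dec-false)
  open import Relation.Nullary.Negation using (¬_; contradiction)
  open import Relation.Unary using (Decidable)
  open FiniteSums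
  open Arithmetic
  open DenseGraphs using (codeg; book-lower-bound)

  -- Lengths of filtered lists as finite sums.

  length-filter-tabulate : ∀ {A : Set} {P : A → Set} (P? : Decidable P) {n} (f : Fin n → A) →
    length (filter P? (tabulate f)) ≡ sum λ i → ⟦ does (P? (f i)) ⟧
  length-filter-tabulate P? {zero}  f = sym (sum-zero _)
  length-filter-tabulate P? {suc n} f = trans step (sym (sum-suc _))
    where
    rec : length (filter P? (tabulate (f ∘ suc))) ≡ sum λ i → ⟦ does (P? (f (suc i))) ⟧
    rec = length-filter-tabulate P? (f ∘ suc)
    step : length (filter P? (tabulate f)) ≡ ⟦ does (P? (f zero)) ⟧ + sum λ i → ⟦ does (P? (f (suc i))) ⟧
    step with does (P? (f zero))
    ... | true  = cong suc rec
    ... | false = rec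

  length-filter-product : ∀ {A B : Set} {P : A × B → Set} (P? : Decidable P) {m n}
    (f : Fin m → A) (g : Fin n → B) →
    length (filter P? (cartesianProduct (tabulate f) (tabulate g)))
      ≡ sum λ i → sum λ j → ⟦ does (P? (f i , g j)) ⟧
  length-filter-product P? {zero}  f g = sym (sum-zero _)
  length-filter-product P? {suc m} f g = begin
    length (filter P? (row ++ rest))
      ≡⟨ cong length (filter-++ P? row rest) ⟩
    length (filter P? row ++ filter P? rest)
      ≡⟨ length-++ (filter P? row) ⟩
    length (filter P? row) + length (filter P? rest)
      ≡⟨ cong₂ _+_ (trans (cong (length ∘ filter P?) (map-tabulate g (f zero ,_)))
           (length-filter-tabulate P? _)) (length-filter-product P? (f ∘ suc) g) ⟩
    sum (λ j → ⟦ does (P? (f zero , g j)) ⟧) + sum (λ i → sum λ j → ⟦ does (P? (f (suc i) , g j)) ⟧)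
      ≡⟨ sum-suc _ ⟨
    sum (λ i → sum λ j → ⟦ does (P? (f i , g j)) ⟧) ∎
    where
    open ≡-Reasoning
    row  = map (f zero ,_) (tabulate g)
    rest = cartesianProduct (tabulate (f ∘ suc)) (tabulate g)

  module _ {n : ℕ} (G : Graph n) where
    open Graph G

    adj : Fin n → Fin n → Bool
    adj u v = does (adj? u v)

    adj-comm : ∀ u v → adj u v ≡ adj v u
    adj-comm u v = does-⇔ (mk⇔ adj-sym adj-sym) (adj? u v) (adj? v u)

    -- `edges` lists only pairs with u < v. These and their transposes make up all adjacent ordered
    -- pairs, as the diagonal has none.
    handshake : 2 * length (edges G) ≡ sum λ u → sum λ v → ⟦ adj u v ⟧
    handshake = begin
      2 * length (edges G)
        ≡⟨ cong (λ k → length (edges G) + k) (+-identityʳ _) ⟩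
      length (edges G) + length (edges G)
        ≡⟨ cong₂ _+_ count-edges (trans count-edges (sum-comm _)) ⟩
      sum (λ u → sum λ v → up u v) + sum (λ u → sum λ v → up v u)
        ≡⟨ sum-+ _ _ ⟨
      sum (λ u → sum (up u) + sum (λ v → up v u))
        ≡⟨ sum-cong (λ u → trans (sym (sum-+ _ _)) (sum-cong (split u))) ⟩
      sum (λ u → sum λ v → ⟦ adj u v ⟧) ∎
      where
      open ≡-Reasoning
      up : Fin n → Fin n → ℕ
      up u v = ⟦ does (u Fin.<? v) ∧ adj u v ⟧
      count-edges : length (edges G) ≡ sum λ u → sum λ v → up u v
      count-edges = length-filter-product _ (λ i → i) (λ i → i)
      split : ∀ u v → up u v + up v u ≡ ⟦ adj u v ⟧
      split u v with Fin.<-cmp u v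
      ... | tri< u<v _ v≮u = trans (cong₂ (λ p q → ⟦ p ∧ adj u v ⟧ + ⟦ q ∧ adj v u ⟧)
        (dec-true (u Fin.<? v) u<v) (dec-false (v Fin.<? u) v≮u)) (+-identityʳ _)
      ... | tri> u≮v _ v<u = trans (cong₂ (λ p q → ⟦ p ∧ adj u v ⟧ + ⟦ q ∧ adj v u ⟧)
        (dec-false (u Fin.<? v) u≮v) (dec-true (v Fin.<? u) v<u)) (cong ⟦_⟧ (adj-comm v u))
      ... | tri≈ u≮v refl _ = trans (cong (λ p → ⟦ p ∧ adj u u ⟧ + ⟦ p ∧ adj u u ⟧)
        (dec-false (u Fin.<? u) u≮v)) (sym (cong ⟦_⟧ (dec-false (adj? u u) (adj-irrefl refl))))

    bookSize≡codeg : ∀ u v → adj u v ≡ true → bookSize G (u , v) ≡ codeg adj u v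
    bookSize≡codeg u v uv = trans (length-filter-tabulate (isTriangle? G u v) λ w → w)
      (sum-cong λ w → trans (cong (λ p → ⟦ p ∧ (adj u w ∧ adj v w) ⟧) uv) (∧⇒* (adj u w) (adj v w)))
      where
      ∧⇒* : ∀ p q → ⟦ p ∧ q ⟧ ≡ ⟦ p ⟧ * ⟦ q ⟧
      ∧⇒* true  q = sym (*-identityˡ ⟦ q ⟧)
      ∧⇒* false q = refl

    bookSize≤bk : ∀ {u v} → u Fin.< v → Adj u v → bookSize G (u , v) ≤ bk G
    bookSize≤bk u<v uv = All.lookup (xs≤max 0 (map (bookSize G) (edges G)))
      (∈-map⁺ (bookSize G) (∈-filter⁺ _ (∈-cartesianProduct⁺ (∈-allFin _) (∈-allFin _)) (u<v , uv)))

    -- `bk` is a maximum over pairs with u < v; the opposite order is reduced to it by symmetry.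
    codeg≤bk : ∀ u v → adj u v ≡ true → codeg adj u v ≤ bk G
    codeg≤bk u v uv with Fin.<-cmp u v
    ... | tri< u<v _ _  = subst (_≤ bk G) (bookSize≡codeg u v uv)
      (bookSize≤bk u<v (does-true (adj? u v) uv))
    ... | tri≈ _ refl _ = contradiction (does-true (adj? u u) uv) (adj-irrefl refl)
    ... | tri> _ _ v<u  = subst (_≤ bk G)
      (trans (bookSize≡codeg v u vu) (sum-cong λ w → *-comm ⟦ adj v w ⟧ ⟦ adj u w ⟧))
      (bookSize≤bk v<u (does-true (adj? v u) vu))
      where
      vu : adj v u ≡ true
      vu = trans (adj-comm v u) uv

    open-triangle : EveryEdgeInTriangle G → ∀ u v → adj u v ≡ true →
                    ∃[ w ] adj u w ≡ true × adj v w ≡ true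
    open-triangle all-in-triangle u v uv with all-in-triangle u v (does-true (adj? u v) uv)
    ... | w , _ , uw , vw = w , dec-true (adj? u w) uw , dec-true (adj? v w) vw

    bk-lower-bound : ∀ {c} (m : ℕ) .{{_ : NonZero n}} .{{_ : NonZero m}} → Admissible c G →
      ℤ.+ (n * n) ≡ ℤ.+ 4 ℤ.* c ℤ.+ ℤ.+ m → 250 * m ≤ n * n →
      n ≤ 1000 * bk G ⊎ n * n * n ≤ 625 * (bk G * bk G * m)
                      ⊎ 4 * (n * n * n * n) ≤ 625 * (m * m * bk G)
    bk-lower-bound {c} m admissible n²≡ = book-lower-bound adj adj-comm (bk G) codeg≤bk m
      (open-triangle (Admissible.triangles admissible)) (ℤ.drop‿+≤+ (begin
        ℤ.+ (n * n)
          ≡⟨ n²≡ ⟩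
        ℤ.+ 4 ℤ.* c ℤ.+ ℤ.+ m
          ≤⟨ ℤ.+-monoˡ-≤ (ℤ.+ m) (ℤ.*-monoˡ-≤-nonNeg (ℤ.+ 4) enoughEdges) ⟩
        ℤ.+ 4 ℤ.* ℤ.+ length (edges G) ℤ.+ ℤ.+ m
          ≡⟨ cong (ℤ._+ ℤ.+ m) (ℤ.pos-* 4 (length (edges G))) ⟨
        ℤ.+ (4 * length (edges G) + m)
          ≡⟨ cong ℤ.+_ (trans (double (length (edges G)) m) (cong (λ s → m + 2 * s) handshake)) ⟩
        ℤ.+ (m + 2 * sum (λ u → sum λ v → ⟦ adj u v ⟧)) ∎))
      where
      open ℤ.≤-Reasoning
      open Admissible admissible
      double : ∀ k m → 4 * k + m ≡ m + 2 * (2 * k)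
      double = solve-∀

  -- Decoding recovers a graph only up to equivalence of adjacency, so its invariants must be seen
  -- to respect that equivalence.
  bk-cong : ∀ {n} (G H : Graph n) → (∀ u v → Graph.Adj G u v ⇔ Graph.Adj H u v) →
            edges G ≡ edges H × bk G ≡ bk H
  bk-cong {n} G H G⇔H = edges≡ , cong (max 0) (trans (map-cong books (edges G)) (cong (map (bookSize H)) edges≡))
    where
    to : ∀ {u v} → Graph.Adj G u v → Graph.Adj H u v
    to {u} {v} = Equivalence.to (G⇔H u v)
    from : ∀ {u v} → Graph.Adj H u v → Graph.Adj G u v
    from {u} {v} = Equivalence.from (G⇔H u v)
    edges≡ : edges G ≡ edges H
    edges≡ = filter-≐ _ _ ((λ (u<v , uv) → u<v , to uv) , (λ (u<v , uv) → u<v , from uv))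
      (cartesianProduct (allFin n) (allFin n))
    books : ∀ e → bookSize G e ≡ bookSize H e
    books (u , v) = cong length (filter-≐ (isTriangle? G u v) (isTriangle? H u v)
      ((λ (uv , uw , vw) → to uv , to uw , to vw) , (λ (uv , uw , vw) → from uv , from uw , from vw)) (allFin n))

  admissible-cong : ∀ {n c} (G H : Graph n) → (∀ u v → Graph.Adj G u v ⇔ Graph.Adj H u v) →
                    Admissible c G → Admissible c H
  admissible-cong {c = c} G H G⇔H admissible = record
    { enoughEdges = subst (λ es → c ℤ.≤ ℤ.+ length es) (proj₁ (bk-cong G H G⇔H)) enoughEdges
    ; triangles   = λ u v uv → map₂ (λ (uv , uw , vw) → to uv , to uw , to vw)
                                    (triangles u v (Equivalence.from (G⇔H u v) uv))
    }
    where
    open Admissible admissible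
    to : ∀ {u v} → Graph.Adj G u v → Graph.Adj H u v
    to {u} {v} = Equivalence.to (G⇔H u v)

  -- Search over all graphs on `n` vertices.

  admissible? : ∀ {n} c (G : Graph n) → Dec (Admissible c G)
  admissible? c G = map′ (λ (p , q) → record { enoughEdges = p ; triangles = q })
    (λ a → Admissible.enoughEdges a , Admissible.triangles a)
    ((c ℤ.≤? ℤ.+ length (edges G)) ×-dec
      Fin.all? λ u → Fin.all? λ v → Graph.adj? G u v →-dec Fin.any? λ w → isTriangle? G u v w)

  -- Reading a subset of Fin (n * n) as a relation and symmetrising it reaches every graph
  -- up to adjacency, so that a search over subsets is a search over graphs.
  decode : ∀ {n} → Subset (n * n) → Graph n
  decode s = record
    { Adj        = λ u v → (entry u v ≡ true × entry v u ≡ true) × ¬ u ≡ v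
    ; adj?       = λ u v → ((entry u v Bool.≟ true) ×-dec (entry v u Bool.≟ true)) ×-dec ¬? (u Fin.≟ v)
    ; adj-sym    = λ ((uv , vu) , u≢v) → (vu , uv) , u≢v ∘ sym
    ; adj-irrefl = λ u≡v (_ , u≢v) → u≢v u≡v
    }
    where
    entry : _ → _ → Bool
    entry u v = lookup s (combine u v)

  encode : ∀ {n} → Graph n → Subset (n * n)
  encode {n} G = Vec.tabulate λ k → adj G (proj₁ (remQuot {n} n k)) (proj₂ (remQuot {n} n k))

  decode-encode : ∀ {n} (G : Graph n) u v → Graph.Adj G u v ⇔ Graph.Adj (decode {n} (encode G)) u v
  decode-encode {n} G u v = mk⇔
    (λ uv → (trans (entry u v) (dec-true (adj? u v) uv) , trans (entry v u) (dec-true (adj? v u) (adj-sym uv)))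
          , λ u≡v → adj-irrefl u≡v uv)
    (λ ((uv , _) , _) → does-true (adj? u v) (trans (sym (entry u v)) uv))
    where
    open Graph G
    entry : ∀ u v → lookup (encode G) (combine u v) ≡ adj G u v
    entry u v = trans (lookup∘tabulate _ (combine u v))
      (cong (λ (i , j) → adj G i j) (Fin.remQuot-combine u v))

  -- The values are tried from 0 upwards, and the witness `k` bounds the search.
  least : ∀ {P : ℕ → Set} → Decidable P → ∀ k → P k → ∃[ g ] P g × ∀ j → P j → g ≤ j
  least {P} P? k Pk = go (below (suc k))
    where
    Least : Set
    Least = ∃[ g ] P g × ∀ j → P j → g ≤ j
    below : ∀ k → Least ⊎ (∀ j → j < k → ¬ P j)
    below zero    = inj₂ λ _ ()
    below (suc k) with below k
    ... | inj₁ found = inj₁ found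
    ... | inj₂ none with P? k
    ...   | yes Pk = inj₁ (k , Pk , λ j Pj → ≮⇒≥ λ j<k → none j j<k Pj)
    ...   | no ¬Pk = inj₂ λ { j (s≤s j≤k) Pj → none j (≤∧≢⇒< j≤k λ { refl → ¬Pk Pj }) Pj }
    go : Least ⊎ (∀ j → j < suc k → ¬ P j) → Least
    go (inj₁ found) = found
    go (inj₂ none)  = contradiction Pk (none k ≤-refl)

  -- There are finitely many codes, so it is decidable whether a book size is attained; the given
  -- graph attains one.
  minimal-bk : ∀ {n} c (G : Graph n) → Admissible c G →
    ∃[ g ] (Σ (Graph n) λ G → Admissible c G × bk G ≡ g) × (∀ G → Admissible c G → g ≤ bk G)
  minimal-bk {n} c G admissible = go (least attained? (bk G) (attained G admissible))
    where
    Attained : ℕ → Set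
    Attained k = ∃[ s ] Admissible c (decode {n} s) × bk (decode {n} s) ≡ k
    attained? : Decidable Attained
    attained? k = anySubset? λ s → admissible? c (decode {n} s) ×-dec (bk (decode {n} s) ≟ k)
    attained : ∀ G → Admissible c G → Attained (bk G)
    attained G a = encode G , admissible-cong G _ (decode-encode G) a
                 , sym (proj₂ (bk-cong G (decode {n} (encode G)) (decode-encode G)))
    go : (∃[ g ] Attained g × ∀ j → Attained j → g ≤ j) → _
    go (g , (s , a , eq) , min) = g , (decode {n} s , a , eq) , λ G a → min (bk G) (attained G a)

  -- The complete graph provides the admissible graph from which the minimisation starts.
  complete : ∀ n → Graph n
  complete n = record
    { Adj        = λ u v → ¬ u ≡ v
    ; adj?       = λ u v → ¬? (u Fin.≟ v)
    ; adj-sym    = λ u≢v → u≢v ∘ sym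
    ; adj-irrefl = λ u≡v u≢v → u≢v u≡v
    }

  complete-triangles : ∀ {n} → 3 ≤ n → EveryEdgeInTriangle (complete n)
  complete-triangles (s≤s (s≤s (s≤s _))) u v u≢v = go u v u≢v
    where
    go : ∀ {k} (u v : Fin (3 + k)) → ¬ u ≡ v → ∃[ w ] IsTriangle (complete (3 + k)) u v w
    go zero          zero          0≢0 = contradiction refl 0≢0
    go zero          (suc zero)    u≢v = suc (suc zero) , u≢v , (λ ()) , (λ ())
    go zero          (suc (suc _)) u≢v = suc zero , u≢v , (λ ()) , (λ ())
    go (suc zero)    zero          u≢v = suc (suc zero) , u≢v , (λ ()) , (λ ())
    go (suc (suc _)) zero          u≢v = suc zero , u≢v , (λ ()) , (λ ())
    go (suc _)       (suc _)       u≢v = zero , u≢v , (λ ()) , (λ ())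

  complete-edges : ∀ n → 2 * length (edges (complete n)) + n ≡ n * n
  complete-edges n = begin
    2 * length (edges (complete n)) + n
      ≡⟨ cong₂ _+_ (handshake (complete n)) (sym (trans (sum-cong one-equal) (sum-one n))) ⟩
    sum (λ u → sum λ v → ⟦ not (does (u Fin.≟ v)) ⟧) + sum (λ u → sum λ v → ⟦ does (u Fin.≟ v) ⟧)
      ≡⟨ sum-+ _ _ ⟨
    sum (λ u → sum (λ v → ⟦ not (does (u Fin.≟ v)) ⟧) + sum (λ v → ⟦ does (u Fin.≟ v) ⟧))
      ≡⟨ sum-cong (λ u → trans (sym (sum-+ _ _)) (trans (sum-cong λ v → go (does (u Fin.≟ v))) (sum-one n))) ⟩
    sum {n} (λ _ → n)
      ≡⟨ sum-cong (λ _ → *-identityʳ n) ⟨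
    sum {n} (λ _ → n * 1)
      ≡⟨ sum-*ˡ {n} n (λ _ → 1) ⟨
    n * sum {n} (λ _ → 1)
      ≡⟨ cong (n *_) (sum-one n) ⟩
    n * n ∎
    where
    open ≡-Reasoning
    go : ∀ p → ⟦ not p ⟧ + ⟦ p ⟧ ≡ 1
    go true  = refl
    go false = refl
    one-equal : ∀ {n} (u : Fin n) → sum (λ v → ⟦ does (u Fin.≟ v) ⟧) ≡ 1
    one-equal {suc n} zero    = trans (sum-suc _) (cong suc (sym (sum-*ˡ {n} 0 λ _ → 0)))
    one-equal         (suc u) = trans (sum-suc _) (one-equal u)

  -- 4c ≤ n² ≤ 2n(n - 1), and the last term is four times the number of edges.
  complete-admissible : ∀ n c m .{{_ : NonZero m}} → ℤ.+ (n * n) ≡ ℤ.+ 4 ℤ.* c ℤ.+ ℤ.+ m →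
                        250 * m ≤ n * n → Admissible c (complete n)
  complete-admissible n c m n²≡ m-small = record
    { enoughEdges = ℤ.*-cancelˡ-≤-pos c (ℤ.+ ε) (ℤ.+ 4) 4c≤4ε
    ; triangles   = complete-triangles 3≤n
    }
    where
    ε : ℕ
    ε = length (edges (complete n))
    3≤n : 3 ≤ n
    -- For n ≤ 2 the square would be at most 4, but it is at least 250m ≥ 250.
    3≤n = ≮⇒≥ λ n<3 → contradiction
      (≤-trans m-small (*-mono-≤ (≤-pred n<3) (≤-pred n<3)))
      (<⇒≱ (≤-trans (m≤m+n 5 245) (*-monoʳ-≤ 250 (>-nonZero⁻¹ m))))
    4c≤4ε : ℤ.+ 4 ℤ.* c ℤ.≤ ℤ.+ 4 ℤ.* ℤ.+ ε
    4c≤4ε = begin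
      ℤ.+ 4 ℤ.* c                  ≤⟨ ℤ.i≤i+j _ (ℤ.+ m) ⟩
      ℤ.+ 4 ℤ.* c ℤ.+ ℤ.+ m        ≡⟨ n²≡ ⟨
      ℤ.+ (n * n)                  ≤⟨ ℤ.+≤+ n²≤4ε ⟩
      ℤ.+ (4 * ε)                  ≡⟨ ℤ.pos-* 4 ε ⟩
      ℤ.+ 4 ℤ.* ℤ.+ ε              ∎
      where
      open ℤ.≤-Reasoning
      2n≤n² : 2 * n ≤ n * n
      2n≤n² = *-monoˡ-≤ n (≤-trans (m≤m+n 2 1) 3≤n)
      n²≤4ε : n * n ≤ 4 * ε
      n²≤4ε = certify 0 2n≤n² (trans (cong (λ q → q + q + 0) (sym (complete-edges n))) (eq ε n))
        where
        eq : ∀ ε n → (2 * ε + n) + (2 * ε + n) + 0 ≡ 4 * ε + 2 * n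
        eq = solve-∀

-- Bounds on reals

module RealBounds where
  open import Data.Integer.Base as ℤ using (ℤ)
  import Data.Integer.Properties as ℤ
  open import Data.Nat.Base as ℕ using (ℕ; suc)
  import Data.Nat.Properties as ℕ
  open import Data.Product.Base using (_×_; _,_)
  open import Data.Rational.Base
  open import Data.Rational.Properties
  open import Data.Rational.Solver using (module +-*-Solver)
  open import Data.Rational.Unnormalised.Base as ℚᵘ using (mkℚᵘ)
  import Data.Rational.Unnormalised.Properties as ℚᵘ
  open import Data.Sum.Base using (inj₁; inj₂)
  open import Relation.Binary.PropositionalEquality
  open RationalOrder
  open Reciprocal
  open FromℤProperties
  open CauchyProperties using (⊔ˡ; ⊔ʳ)
  open Positivity
  open ReciprocalEstimates
  open SquareRootEstimates

  fromℤ-cancel-≤ : ∀ {y z} → fromℤ y ≤ fromℤ z → y ℤ.≤ z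
  fromℤ-cancel-≤ y≤z = ℤ.≮⇒≥ λ z<y → <-irrefl refl (<-≤-trans (fromℤ-mono-< z<y) y≤z)

  fromℤ-cancel-< : ∀ {y z} → fromℤ y < fromℤ z → y ℤ.< z
  fromℤ-cancel-< y<z = ℤ.≰⇒> λ z≤y → <-irrefl refl (<-≤-trans y<z (fromℤ-mono-≤ z≤y))

  /-* : ∀ i d .{{_ : ℕ.NonZero d}} → (i / d) * fromℕ d ≡ fromℤ i
  /-* i (suc d) = toℚᵘ-injective (ℚᵘ.≃-trans (toℚᵘ-homo-* (i / suc d) (fromℕ (suc d)))
    (ℚᵘ.≃-trans (ℚᵘ.*-cong (toℚᵘ-fromℚᵘ (mkℚᵘ i d)) (toℚᵘ-fromℤ (ℤ.+ suc d)))
      (ℚᵘ.≃-trans (ℚᵘ.*≡* (trans (ℤ.*-identityʳ (i ℤ.* ℤ.+ suc d))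
        (cong (λ k → i ℤ.* ℤ.+ k) (sym (ℕ.*-identityʳ (suc d)))))) (ℚᵘ.≃-sym (toℚᵘ-fromℤ i)))))

  -- Otherwise some `r` lies strictly between `q` and `p`, and ε = r - q yields p ≤ r.
  ≤-closed : ∀ {p q} → (∀ ε → 0ℚ < ε → p ≤ q + ε) → p ≤ q
  ≤-closed {p} {q} h = ≮⇒≥ λ q<p → let r , q<r , r<p = <-dense q<p in
    <-irrefl refl (<-≤-trans r<p (subst (p ≤_) (q+[p-q]≡p r q) (h (r - q) (p<q⇒0<q-p q<r))))
    where
    p<q⇒0<q-p : ∀ {p q} → p < q → 0ℚ < q - p
    p<q⇒0<q-p {p} {q} p<q = subst (_< q - p) (+-inverseʳ p) (+-monoˡ-< (- p) p<q)

  eventually-× : ∀ {P Q : ℕ → Set} → Eventually P → Eventually Q → Eventually λ k → P k × Q k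
  eventually-× (M , p) (N , q) = M ℕ.⊔ N , λ k k≥ → p k (⊔ˡ k≥) , q k (⊔ʳ {M} k≥)

  eventually-map : ∀ {P Q : ℕ → Set} → (∀ k → P k → Q k) → Eventually P → Eventually Q
  eventually-map f (N , p) = N , λ k k≥ → f k (p k k≥)

  eventually-holds : ∀ {P : Set} → Eventually (λ _ → P) → P
  eventually-holds (N , p) = p N ℕ.≤-refl

  eventually-nonNeg : (x : ℝ⁺) → Eventually λ k → 0ℚ ≤ seq (value x) k
  eventually-nonNeg x with away x
  ... | δ , 0<δ , δ≤x = eventually-map (λ k → ≤-trans (<⇒≤ 0<δ)) δ≤x

  half-< : ∀ {ε} → 0ℚ < ε → ½ * ε < ε
  half-< {ε} 0<ε = subst₂ _<_ (+-identityʳ (½ * ε)) (half+half ε) (+-monoʳ-< (½ * ε) (half-pos 0<ε))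

  ⊓ᴿ-≤ˡ : ∀ x y {z} → x ≤ᴿ z → x ⊓ᴿ y ≤ᴿ z
  ⊓ᴿ-≤ˡ x y x≤z ε 0<ε = eventually-map (λ k → ≤-trans (p⊓q≤p (seq x k) (seq y k))) (x≤z ε 0<ε)

  ⊓ᴿ-≤ʳ : ∀ x y {z} → y ≤ᴿ z → x ⊓ᴿ y ≤ᴿ z
  ⊓ᴿ-≤ʳ x y y≤z ε 0<ε = eventually-map (λ k → ≤-trans (p⊓q≤q (seq x k) (seq y k))) (y≤z ε 0<ε)

  module _ {c : ℚ} (0<c : 0ℚ < c) where
    private
      rescale : ∀ q ε → c * (q + ε * inv c) ≡ c * q + ε
      rescale q ε = trans (solve 4 (λ c q ε i → c :* (q :+ ε :* i) := c :* q :+ (c :* i) :* ε) refl c q ε (inv c))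
        (cong (λ e → c * q + e) (cancel-inv ε 0<c))
        where open +-*-Solver

    *-monoˡ-≤ᴿ : ∀ x y → x ≤ᴿ y → fromℚ c *ᴿ x ≤ᴿ fromℚ c *ᴿ y
    *-monoˡ-≤ᴿ x y x≤y ε 0<ε = eventually-map
      (λ k h → subst (c * seq x k ≤_) (rescale (seq y k) ε) (*-monoˡ-≤-nonNeg c {{nonNegative (<⇒≤ 0<c)}} h))
      (x≤y (ε * inv c) (*-pos 0<ε (inv-pos 0<c)))

  square-≤ᴿ : ∀ {q} (x : ℝ⁺) → 0ℚ < q → fromℚ q ≤ᴿ value x → fromℚ (q * q) ≤ᴿ value x *ᴿ value x
  square-≤ᴿ {q} x 0<q q≤x ε 0<ε = eventually-map
    (λ k ((0≤x , h)) → estimate {seq (value x) k} 0≤x h)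
    (eventually-× (eventually-nonNeg x) (q≤x η (half-pos (*-pos 0<ε (inv-pos 0<q)))))
    where
    open +-*-Solver
    η : ℚ
    -- Chosen so that the two errors ηq in `estimate` add up to `ε`.
    η = ½ * (ε * inv q)
    2ηq≡ε : η * q + η * q ≡ ε
    2ηq≡ε = trans
      (solve 4 (λ h ε i q → h :* (ε :* i) :* q :+ h :* (ε :* i) :* q
                         := h :* (q :* i) :* ε :+ h :* (q :* i) :* ε) refl ½ ε (inv q) q)
      (trans (cong (λ j → ½ * j * ε + ½ * j * ε) (inv-inverseʳ 0<q)) (half+half ε))
    -- For x < q, q² ≤ q(x + η) and qx ≤ (x + η)x ≤ x² + ηq.
    estimate : ∀ {x} → 0ℚ ≤ x → q ≤ x + η → q * q ≤ x * x + ε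
    estimate {x} 0≤x q≤ with ≤-total q x
    ... | inj₁ q≤x = ≤-trans (sq-mono-≤ (<⇒≤ 0<q) q≤x) (p≤p+q (x * x) (<⇒≤ 0<ε))
    ... | inj₂ x≤q = ≤-trans (*-monoˡ-≤ q (<⇒≤ 0<q) q≤) (subst₂ _≤_
      (solve 3 (λ x q η → q :* x :+ η :* q := (x :+ η) :* q) refl x q η)
      (trans (solve 3 (λ x q η → (x :* x :+ η :* q) :+ η :* q := x :* x :+ (η :* q :+ η :* q)) refl x q η)
        (cong (λ e → x * x + e) 2ηq≡ε))
      (+-monoˡ-≤ (η * q) (≤-trans (*-monoˡ-≤ x 0≤x q≤) (subst (_≤ x * x + η * q)
        (solve 2 (λ x η → x :* x :+ η :* x := (x :+ η) :* x) refl x η)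
        (+-monoʳ-≤ (x * x) (*-monoˡ-≤-nonNeg η {{nonNegative 0≤η}} x≤q))))))
      where
      0≤η : 0ℚ ≤ η
      0≤η = <⇒≤ (half-pos (*-pos 0<ε (inv-pos 0<q)))

  -- `√-modulus` applies with the constant `q`, whose square is at most `p`, as one of the two
  -- approximate roots.
  √-≤ᴿ : ∀ {p q} (x : ℝ⁺) → q * q ≤ p → fromℚ p ≤ᴿ value x → fromℚ q ≤ᴿ value (√ x)
  √-≤ᴿ {p} {q} x q²≤p p≤x ε 0<ε = eventually-map
    (λ k (((0≤x , p≤) , u<h)) → let open √ℚ-properties (x̂ k) 0≤x k in
      <⇒≤ (subst (λ e → q < t + e) (half+half ε)
        (√-modulus {p} {x̂ k} {q} {t} {u} h 0<h 0≤t u<h q²≤p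
          (≤-trans 0≤t (p≤p+q t (<⇒≤ (inv-pos (fromℕ-pos (suc k)))))) upper
          (≤-<-trans p≤ (+-monoʳ-< (x̂ k) (half-< (*-pos 0<h 0<h)))))))
    (eventually-× (eventually-× (eventually-nonNeg x) (p≤x (½ * (h * h)) (half-pos (*-pos 0<h 0<h))))
      (archimedean 0<h))
    where
    x̂ : ℕ → ℚ
    x̂ = seq (value x)
    h : ℚ
    h = ½ * ε
    0<h : 0ℚ < h
    0<h = half-pos 0<ε

  ⁻¹-≤ᴿ : ∀ {q} (x : ℝ⁺) → 0ℚ < q → fromℚ q ≤ᴿ value x → value (x ⁻¹) ≤ᴿ fromℚ (inv q)
  ⁻¹-≤ᴿ {q} x 0<q q≤x ε 0<ε = bound (away x)
    where
    bound : Away (seq (value x)) → Eventually λ k → inv (seq (value x) k) ≤ inv q + ε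
    bound (δ , 0<δ , δ≤x) = eventually-map
      (λ k ((δ≤ , q≤)) → <⇒≤ (inv-lipschitz {seq (value x) k} {q} {η} ε 0<η 0<ε
        (≤-trans (p⊓q≤p δ q) δ≤) (p⊓q≤q δ q)
        (≤-<-trans q≤ (+-monoʳ-< (seq (value x) k) (half-< 0<εη²)))))
      (eventually-× δ≤x (q≤x (½ * (ε * (η * η))) (half-pos 0<εη²)))
      where
      η : ℚ
      -- A common positive lower bound of the sequence and of `q`, as `inv-lipschitz` requires.
      η = δ ⊓ q
      0<η : 0ℚ < η
      0<η with ⊓-sel δ q
      ... | inj₁ eq = subst (0ℚ <_) (sym eq) 0<δ
      ... | inj₂ eq = subst (0ℚ <_) (sym eq) 0<q
      0<εη² : 0ℚ < ε * (η * η)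
      0<εη² = *-pos 0<ε (*-pos 0<η 0<η)

  -- c/x ≤ c/q ≤ p.
  /-≤ᴿ : ∀ {c p q} (x : ℝ⁺) → 0ℚ < c → 0ℚ < q → fromℚ q ≤ᴿ value x → c ≤ p * q →
         fromℚ c *ᴿ value (x ⁻¹) ≤ᴿ fromℚ p
  /-≤ᴿ {c} {p} {q} x 0<c 0<q q≤x c≤pq ε 0<ε = eventually-map
    (λ k h → ≤-trans h (+-monoˡ-≤ ε c/q≤p))
    (*-monoˡ-≤ᴿ 0<c (value (x ⁻¹)) (fromℚ (inv q)) (⁻¹-≤ᴿ x 0<q q≤x) ε 0<ε)
    where
    c/q≤p : c * inv q ≤ p
    c/q≤p = ≤-trans (*-monoˡ-≤ (inv q) (<⇒≤ (inv-pos 0<q)) c≤pq) (≤-reflexive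
      (trans (*-assoc p q (inv q)) (trans (cong (p *_) (inv-inverseʳ 0<q)) (*-identityʳ p))))

-- The threshold as a rational number

module Threshold (f : (n : ℕ) .{{_ : NonZero n}} → ℝ⁺) (n : ℕ) .{{n≢0 : NonZero n}}
                 (integral : IsInteger (edgeThreshold f n))
                 (f≤n/1000 : value (f n) ≤ᴿ fromℚ (+ n / 1000)) where
  open import Data.Integer.Base as ℤ using (ℤ)
  import Data.Integer.Properties as ℤ
  import Data.Nat.Base as ℕ
  import Data.Nat.Properties as ℕ
  import Data.Integer.Tactic.RingSolver as ℤ-Solver
  open import Data.Product.Base using (Σ; _,_; proj₁; proj₂)
  open import Data.Rational.Base hiding (NonZero)
  open import Data.Rational.Properties
  open import Data.Rational.Solver using (module +-*-Solver)
  open import Data.Sum.Base using (_⊎_; inj₁; inj₂)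
  open import Relation.Binary.PropositionalEquality
  open import Relation.Nullary.Negation using (contradiction)
  open RationalOrder
  open Reciprocal
  open FromℤProperties
  open Positivity
  open ReciprocalEstimates
  open RealBounds
  open +-*-Solver using (solve; _:+_; _:*_; _:-_; :-_; _:=_; con)

  z : ℤ
  z = proj₁ integral

  x s : ℕ → ℚ
  x = seq (value (f n))
  s = seq (edgeThreshold f n)

  n̂ ẑ n²/4 : ℚ
  n̂    = fromℕ n
  ẑ    = fromℤ z
  n²/4 = + (n ℕ.* n) / 4

  0<n̂ : 0ℚ < n̂
  0<n̂ = fromℕ-pos n

  threshold-ceiling : IsCeiling (edgeThreshold f n) z
  -- An integer is its own ceiling; once `s` is within ½ of `z`, it exceeds z - 1 by at least the
  -- witness ½.
  threshold-ceiling = (½ , 0<½ , eventually-map (λ k h → <⇒≤ (lower h)) (proj₂ integral ½ 0<½))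
          , λ ε 0<ε → eventually-map (λ k h → <⇒≤ (∣p-q∣<ε⇒p<q+ε {s k} {ẑ} h)) (proj₂ integral ε 0<ε)
    where
    lower : ∀ {t} → ∣ t - ẑ ∣ < ½ → fromℤ (z ℤ.- + 1) + ½ < t
    lower {t} h = subst₂ _<_
      (trans (solve 1 (λ z → z :+ con (- ½) := (z :+ con (- 1ℚ)) :+ con ½) refl ẑ)
        (cong (λ y → y + ½) (sym (fromℤ-+ z (ℤ.- + 1)))))
      (solve 1 (λ t → (t :+ con ½) :+ con (- ½) := t) refl t)
      (+-monoˡ-< (- ½) (∣p-q∣<ε⇒p<q+ε {ẑ} {t} (subst (_< ½) (∣p-q∣≡∣q-p∣ t ẑ) h)))

  4*n²/4 : fromℕ 4 * n²/4 ≡ fromℕ (n ℕ.* n)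
  4*n²/4 = trans (*-comm (fromℕ 4) n²/4) (/-* (+ (n ℕ.* n)) 4)

  -- f(n) eventually stays above some δ > 0, so as soon as `s` is within nδ of `z`, z < s + nδ ≤
  -- n²/4.
  z<n²/4 : ẑ < n²/4
  z<n²/4 = bound (away (f n))
    where
    bound : Away x → ẑ < n²/4
    bound (δ , 0<δ , δ≤x) = eventually-holds (eventually-map (λ k ((δ≤ , h)) →
        <-≤-trans (∣p-q∣<ε⇒p<q+ε {ẑ} {s k} (subst (_< n̂ * δ) (∣p-q∣≡∣q-p∣ (s k) ẑ) h))
          (subst (s k + n̂ * δ ≤_) (solve 3 (λ q n x → (q :- n :* x) :+ n :* x := q) refl n²/4 n̂ (x k))
            (+-monoʳ-≤ (s k) (*-monoˡ-≤-nonNeg n̂ {{nonNegative (<⇒≤ 0<n̂)}} δ≤))))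
      (eventually-× δ≤x (proj₂ integral (n̂ * δ) (*-pos 0<n̂ 0<δ))))

  -- The two summands of n²/4 = s + n f(n) each contribute an error of ε/2, and `≤-closed` removes
  -- it since both sides are rational.
  n²/4≤ : n²/4 ≤ ẑ + n̂ * (+ n / 1000)
  n²/4≤ = ≤-closed λ ε 0<ε → eventually-holds (eventually-map (λ k ((s≈z , x≤)) → begin
      n²/4
        ≡⟨ solve 3 (λ q n x → q := (q :- n :* x) :+ n :* x) refl n²/4 n̂ (x k) ⟩
      s k + n̂ * x k
        ≤⟨ +-mono-≤ (<⇒≤ (∣p-q∣<ε⇒p<q+ε {s k} {ẑ} s≈z))
             (*-monoˡ-≤-nonNeg n̂ {{nonNegative (<⇒≤ 0<n̂)}} x≤) ⟩
      (ẑ + ½ * ε) + n̂ * (+ n / 1000 + ½ * ε * inv n̂)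
        ≡⟨ solve 5 (λ z h n t i → (z :+ h) :+ n :* (t :+ h :* i) := (z :+ n :* t) :+ (h :+ (n :* i) :* h))
             refl ẑ (½ * ε) n̂ (+ n / 1000) (inv n̂) ⟩
      (ẑ + n̂ * (+ n / 1000)) + (½ * ε + n̂ * inv n̂ * (½ * ε))
        ≡⟨ cong (λ e → (ẑ + n̂ * (+ n / 1000)) + e)
             (trans (cong (λ e → ½ * ε + e) (cancel-inv (½ * ε) 0<n̂)) (half+half ε)) ⟩
      (ẑ + n̂ * (+ n / 1000)) + ε ∎)
    (eventually-× (proj₂ integral (½ * ε) (half-pos 0<ε))
      (f≤n/1000 (½ * ε * inv n̂) (*-pos (half-pos 0<ε) (inv-pos 0<n̂)))))
    where open ≤-Reasoning

  4z<n² : + 4 ℤ.* z ℤ.< + (n ℕ.* n)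
  4z<n² = fromℤ-cancel-< (subst₂ _<_ (sym (fromℤ-* (+ 4) z)) 4*n²/4
    (*-monoʳ-<-pos (fromℕ 4) z<n²/4))

  -- m ≡ n² − 4z = 4 n f(n).
  m : ℕ
  m = ℤ.∣ + (n ℕ.* n) ℤ.- + 4 ℤ.* z ∣

  +m≡ : + m ≡ + (n ℕ.* n) ℤ.- + 4 ℤ.* z
  +m≡ = ℤ.0≤i⇒+∣i∣≡i (ℤ.i≤j⇒0≤j-i (ℤ.<⇒≤ 4z<n²))

  n²≡4z+m : + (n ℕ.* n) ≡ + 4 ℤ.* z ℤ.+ + m
  n²≡4z+m = trans (eq (+ (n ℕ.* n)) (+ 4 ℤ.* z)) (cong (λ k → + 4 ℤ.* z ℤ.+ k) (sym +m≡))
    where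
    eq : ∀ i j → i ≡ j ℤ.+ (i ℤ.- j)
    eq = ℤ-Solver.solve-∀

  instance
    m≢0 : NonZero m
    m≢0 = ℕ.≢-nonZero λ m≡0 → ℤ.<⇒≢ 4z<n² (trans (sym (ℤ.+-identityʳ _))
      (trans (cong (λ k → + 4 ℤ.* z ℤ.+ + k) (sym m≡0)) (sym n²≡4z+m)))

  250m≤n² : 250 ℕ.* m ℕ.≤ n ℕ.* n
  250m≤n² = ℤ.drop‿+≤+ (begin
    + (250 ℕ.* m)                                         ≡⟨ ℤ.pos-* 250 m ⟩
    + 250 ℤ.* + m                                         ≡⟨ cong (+ 250 ℤ.*_) +m≡ ⟩
    + 250 ℤ.* (N ℤ.- + 4 ℤ.* z)                           ≡⟨ expand N z ⟩
    + 250 ℤ.* N ℤ.- + 1000 ℤ.* z                          ≤⟨ ℤ.+-monoˡ-≤ (ℤ.- (+ 1000 ℤ.* z)) scaled ⟩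
    (+ 1000 ℤ.* z ℤ.+ N) ℤ.- + 1000 ℤ.* z                 ≡⟨ cancel N (+ 1000 ℤ.* z) ⟩
    N                                                     ∎)
    where
    open ℤ.≤-Reasoning
    N : ℤ
    N = + (n ℕ.* n)
    expand : ∀ i j → + 250 ℤ.* (i ℤ.- + 4 ℤ.* j) ≡ + 250 ℤ.* i ℤ.- + 1000 ℤ.* j
    expand = ℤ-Solver.solve-∀
    cancel : ∀ i j → (j ℤ.+ i) ℤ.- j ≡ i
    cancel = ℤ-Solver.solve-∀
    scaled : + 250 ℤ.* N ℤ.≤ + 1000 ℤ.* z ℤ.+ N
    scaled = fromℤ-cancel-≤ (subst₂ _≤_
      (trans (cong (_* n²/4) (fromℕ-* 250 4)) (trans (trans (*-assoc (fromℕ 250) (fromℕ 4) n²/4)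
        (cong (fromℕ 250 *_) 4*n²/4)) (sym (fromℤ-* (+ 250) N))))
      (trans (solve 4 (λ c z n t → c :* (z :+ n :* t) := c :* z :+ n :* (t :* c)) refl (fromℕ 1000) ẑ n̂ (+ n / 1000))
        (trans (cong₂ (λ i j → i + n̂ * j) (sym (fromℤ-* (+ 1000) z)) (/-* (+ n) 1000))
          (trans (cong (λ j → fromℤ (+ 1000 ℤ.* z) + j) (sym (fromℕ-* n n))) (sym (fromℤ-+ (+ 1000 ℤ.* z) N)))))
      (*-monoˡ-≤-nonNeg (fromℕ 1000) n²/4≤))

  -- Integrality of the threshold makes the real f(n) equal to this rational.
  F : ℚ
  F = (n²/4 - ẑ) * inv n̂

  n*F : n̂ * F ≡ n²/4 - ẑ
  n*F = trans (solve 3 (λ n d i → n :* (d :* i) := (n :* i) :* d) refl n̂ (n²/4 - ẑ) (inv n̂))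
    (cancel-inv (n²/4 - ẑ) 0<n̂)

  4n*F : fromℕ 4 * (n̂ * F) ≡ fromℕ m
  4n*F = begin
    fromℕ 4 * (n̂ * F)
      ≡⟨ cong (fromℕ 4 *_) n*F ⟩
    fromℕ 4 * (n²/4 - ẑ)
      ≡⟨ solve 3 (λ c q z → c :* (q :- z) := c :* q :- c :* z) refl (fromℕ 4) n²/4 ẑ ⟩
    fromℕ 4 * n²/4 - fromℕ 4 * ẑ
      ≡⟨ cong (λ i → i - fromℕ 4 * ẑ) (trans 4*n²/4 (trans (cong fromℤ n²≡4z+m)
           (trans (fromℤ-+ (+ 4 ℤ.* z) (+ m)) (cong (_+ fromℕ m) (fromℤ-* (+ 4) z))))) ⟩
    (fromℕ 4 * ẑ + fromℕ m) - fromℕ 4 * ẑ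
      ≡⟨ solve 2 (λ i j → (i :+ j) :- i := j) refl (fromℕ 4 * ẑ) (fromℕ m) ⟩
    fromℕ m ∎
    where open ≡-Reasoning

  0<F : 0ℚ < F
  0<F = *-pos (subst (_< n²/4 - ẑ) (+-inverseʳ ẑ) (+-monoˡ-< (- ẑ) z<n²/4)) (inv-pos 0<n̂)

  -- Lower bounds on f(n) are wanted because it stands in denominators.
  F≤f : fromℚ F ≤ᴿ value (f n)
  F≤f ε 0<ε = eventually-map
    (λ k h → *-cancelʳ-≤ n̂ 0<n̂ (subst₂ _≤_
      (trans (solve 3 (λ s y z → (s :+ y) :- z := (s :- z) :+ y) refl (s k) (n̂ * x k) ẑ)
        (trans (solve 4 (λ q n x z → ((q :- n :* x) :- z) :+ n :* x := q :- z) refl n²/4 n̂ (x k) ẑ)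
          (trans (sym n*F) (*-comm n̂ F))))
      (solve 4 (λ z n x ε → ((z :+ n :* ε) :+ n :* x) :- z := (x :+ ε) :* n) refl ẑ n̂ (x k) ε)
      (+-monoˡ-≤ (- ẑ) (+-monoˡ-≤ (n̂ * x k) (<⇒≤ (∣p-q∣<ε⇒p<q+ε {s k} {ẑ} h))))))
    (proj₂ integral (n̂ * ε) (*-pos 0<n̂ 0<ε))

  fromℕ-mono-≤ : ∀ {i j} → i ℕ.≤ j → fromℕ i ≤ fromℕ j
  fromℕ-mono-≤ i≤j = fromℤ-mono-≤ (ℤ.+≤+ i≤j)

  -- From the integer inequalities to the three real bounds.

  module _ (b : ℕ) where
    b̂ : ℚ
    b̂ = fromℕ b

    third-bound : n ℕ.≤ 1000 ℕ.* b → fromℚ (+ n / 1000) ≤ᴿ fromℚ b̂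
    third-bound n≤ ε 0<ε = 0 , λ _ _ → ≤-trans
      (*-cancelʳ-≤ (fromℕ 1000) (fromℕ-pos 1000) (subst₂ _≤_ (sym (/-* (+ n) 1000))
        (trans (fromℕ-* 1000 b) (*-comm (fromℕ 1000) b̂)) (fromℕ-mono-≤ n≤)))
      (p≤p+q b̂ (<⇒≤ 0<ε))

    -- Substituting m = 4nF and dividing by 4n² turns the hypothesis into n² ≤ 2500F²b.
    second-bound : 4 ℕ.* (n ℕ.* n ℕ.* n ℕ.* n) ℕ.≤ 625 ℕ.* (m ℕ.* m ℕ.* b) →
      value ((fromℕ⁺ n *⁺ fromℕ⁺ n) /⁺ (fromℕ⁺ 2500 *⁺ (f n *⁺ f n))) ≤ᴿ fromℚ b̂
    second-bound h = /-≤ᴿ {n̂ * n̂} {b̂} {fromℕ 2500 * (F * F)} (fromℕ⁺ 2500 *⁺ (f n *⁺ f n))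
      (*-pos 0<n̂ 0<n̂) (*-pos (fromℕ-pos 2500) 0<FF)
      (*-monoˡ-≤ᴿ (fromℕ-pos 2500) (fromℚ (F * F)) (value (f n) *ᴿ value (f n)) (square-≤ᴿ (f n) 0<F F≤f))
      (*-cancelʳ-≤ D 0<D (subst₂ _≤_ lhs rhs (fromℕ-mono-≤ h)))
      where
      0<FF : 0ℚ < F * F
      0<FF = *-pos 0<F 0<F
      D : ℚ
      D = fromℕ 4 * (n̂ * n̂)
      0<D : 0ℚ < D
      0<D = *-pos (fromℕ-pos 4) (*-pos 0<n̂ 0<n̂)
      lhs : fromℕ (4 ℕ.* (n ℕ.* n ℕ.* n ℕ.* n)) ≡ (n̂ * n̂) * D
      lhs = trans (fromℕ-* 4 (n ℕ.* n ℕ.* n ℕ.* n)) (trans (cong (fromℕ 4 *_)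
        (trans (fromℕ-* (n ℕ.* n ℕ.* n) n) (cong (_* n̂)
          (trans (fromℕ-* (n ℕ.* n) n) (cong (_* n̂) (fromℕ-* n n))))))
        (solve 2 (λ c n → c :* (((n :* n) :* n) :* n) := (n :* n) :* (c :* (n :* n))) refl (fromℕ 4) n̂))
      rhs : fromℕ (625 ℕ.* (m ℕ.* m ℕ.* b)) ≡ (b̂ * (fromℕ 2500 * (F * F))) * D
      rhs = trans (fromℕ-* 625 (m ℕ.* m ℕ.* b)) (trans (cong (fromℕ 625 *_)
        (trans (fromℕ-* (m ℕ.* m) b) (cong (_* b̂) (trans (fromℕ-* m m)
          (sym (cong₂ _*_ 4n*F 4n*F))))))
        (trans (solve 5 (λ d c n F b → d :* ((c :* (n :* F) :* (c :* (n :* F))) :* b)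
                                    := (b :* (d :* c :* (F :* F))) :* (c :* (n :* n)))
            refl (fromℕ 625) (fromℕ 4) n̂ F b̂)
          (cong (λ c → b̂ * (c * (F * F)) * D) (sym (fromℕ-* 625 4)))))

    -- The root of `F` may be irrational, so it is replaced by r = n/(50b): the hypothesis says r² ≤
    -- F, hence r ≤ √f(n), and n/(50r) = b.
    first-bound : n ℕ.* n ℕ.* n ℕ.≤ 625 ℕ.* (b ℕ.* b ℕ.* m) →
      value (fromℕ⁺ n /⁺ (fromℕ⁺ 50 *⁺ √ (f n))) ≤ᴿ fromℚ b̂
    first-bound h = /-≤ᴿ {n̂} {b̂} {fromℕ 50 * r} (fromℕ⁺ 50 *⁺ √ (f n))
      0<n̂ (*-pos (fromℕ-pos 50) 0<r)
      (*-monoˡ-≤ᴿ (fromℕ-pos 50) (fromℚ r) (value (√ (f n))) (√-≤ᴿ (f n) r²≤F F≤f))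
      (≤-reflexive (trans (sym r*50b) (solve 3 (λ r c b → r :* (c :* b) := b :* (c :* r)) refl r (fromℕ 50) b̂)))
      where
      instance
        b≢0 : NonZero b
        b≢0 = ℕ.≢-nonZero λ { refl → contradiction h (ℕ.<⇒≱ (ℕ.>-nonZero⁻¹ (n ℕ.* n ℕ.* n)
          {{ℕ.m*n≢0 (n ℕ.* n) n {{ℕ.m*n≢0 n n}}}})) }
      0<50b : 0ℚ < fromℕ 50 * b̂
      0<50b = *-pos (fromℕ-pos 50) (fromℕ-pos b)
      r : ℚ
      r = n̂ * inv (fromℕ 50 * b̂)
      0<r : 0ℚ < r
      0<r = *-pos 0<n̂ (inv-pos 0<50b)
      r*50b : r * (fromℕ 50 * b̂) ≡ n̂
      r*50b = trans (*-assoc n̂ (inv (fromℕ 50 * b̂)) (fromℕ 50 * b̂))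
        (trans (cong (n̂ *_) (inv-inverseˡ 0<50b)) (*-identityʳ n̂))
      D : ℚ
      D = (fromℕ 50 * b̂) * (fromℕ 50 * b̂) * n̂
      r²≤F : r * r ≤ F
      r²≤F = *-cancelʳ-≤ D (*-pos (*-pos 0<50b 0<50b) 0<n̂) (subst₂ _≤_ lhs rhs (fromℕ-mono-≤ h))
        where
        lhs : fromℕ (n ℕ.* n ℕ.* n) ≡ (r * r) * D
        lhs = trans (fromℕ-* (n ℕ.* n) n) (trans (cong (_* n̂) (trans (fromℕ-* n n)
          (sym (cong₂ _*_ r*50b r*50b))))
          (solve 3 (λ r d n → ((r :* d) :* (r :* d)) :* n := (r :* r) :* (d :* d :* n)) refl r (fromℕ 50 * b̂) n̂))
        rhs : fromℕ (625 ℕ.* (b ℕ.* b ℕ.* m)) ≡ F * D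
        rhs = trans (fromℕ-* 625 (b ℕ.* b ℕ.* m)) (trans (cong (fromℕ 625 *_)
          (trans (fromℕ-* (b ℕ.* b) m) (cong₂ _*_ (fromℕ-* b b) (sym 4n*F))))
          (trans (solve 5 (λ d c n F b → d :* ((b :* b) :* (c :* (n :* F))) := (d :* c) :* (F :* (b :* b :* n)))
              refl (fromℕ 625) (fromℕ 4) n̂ F b̂)
            (trans (cong (λ c → c * (F * (b̂ * b̂ * n̂))) (trans (sym (fromℕ-* 625 4)) (fromℕ-* 50 50)))
            (solve 4 (λ e F b n → (e :* e) :* (F :* (b :* b :* n)) := F :* ((e :* b) :* (e :* b) :* n))
              refl (fromℕ 50) F b̂ n̂))))

    BookBounds : Set
    BookBounds = n ℕ.≤ 1000 ℕ.* b ⊎ n ℕ.* n ℕ.* n ℕ.≤ 625 ℕ.* (b ℕ.* b ℕ.* m)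
                 ⊎ 4 ℕ.* (n ℕ.* n ℕ.* n ℕ.* n) ℕ.≤ 625 ℕ.* (m ℕ.* m ℕ.* b)

    minimum-bound : BookBounds →
      value (fromℕ⁺ n /⁺ (fromℕ⁺ 50 *⁺ √ (f n)))
      ⊓ᴿ value ((fromℕ⁺ n *⁺ fromℕ⁺ n) /⁺ (fromℕ⁺ 2500 *⁺ (f n *⁺ f n)))
      ⊓ᴿ fromℚ (+ n / 1000)
      ≤ᴿ fromℚ b̂
    minimum-bound = go
      (value (fromℕ⁺ n /⁺ (fromℕ⁺ 50 *⁺ √ (f n))))
      (value ((fromℕ⁺ n *⁺ fromℕ⁺ n) /⁺ (fromℕ⁺ 2500 *⁺ (f n *⁺ f n))))
      (fromℚ (+ n / 1000)) first-bound second-bound third-bound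
      where
      go : ∀ x₁ x₂ x₃ {P₁ P₂ P₃ : Set} → (P₁ → x₁ ≤ᴿ fromℚ b̂) → (P₂ → x₂ ≤ᴿ fromℚ b̂) →
           (P₃ → x₃ ≤ᴿ fromℚ b̂) → P₃ ⊎ P₁ ⊎ P₂ → x₁ ⊓ᴿ x₂ ⊓ᴿ x₃ ≤ᴿ fromℚ b̂
      go x₁ x₂ x₃ b₁ b₂ b₃ (inj₁ h)        = ⊓ᴿ-≤ʳ (x₁ ⊓ᴿ x₂) x₃ {fromℚ b̂} (b₃ h)
      go x₁ x₂ x₃ b₁ b₂ b₃ (inj₂ (inj₁ h)) = ⊓ᴿ-≤ˡ (x₁ ⊓ᴿ x₂) x₃ {fromℚ b̂}
        (⊓ᴿ-≤ˡ x₁ x₂ {fromℚ b̂} (b₁ h))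
      go x₁ x₂ x₃ b₁ b₂ b₃ (inj₂ (inj₂ h)) = ⊓ᴿ-≤ˡ (x₁ ⊓ᴿ x₂) x₃ {fromℚ b̂}
        (⊓ᴿ-≤ʳ x₁ x₂ {fromℚ b̂} (b₂ h))

  open Books

  -- The bounds hold for every admissible graph, in particular for one that attains the minimum.
  γ-exists : ∃[ g ] IsGamma f n g × BookBounds g
  γ-exists = go (minimal-bk z (complete n) (complete-admissible n z m n²≡4z+m 250m≤n²))
    where
    go : ∃[ g ] (Σ (Graph n) λ G → Admissible z G × bk G ≡ g) × (∀ G → Admissible z G → g ℕ.≤ bk G) →
         ∃[ g ] IsGamma f n g × BookBounds g
    go (g , (G , admissible , bk≡g) , minimal) = g
      , record { c = z ; ceil = threshold-ceiling ; attained = G , admissible , bk≡g ; minimal = minimal }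
      , subst BookBounds bk≡g (bk-lower-bound G m admissible n²≡4z+m 250m≤n²)

corollary1p4 : (f : (n : ℕ) .{{_ : NonZero n}} → ℝ⁺) (n : ℕ) .{{_ : NonZero n}} →
    IsInteger (edgeThreshold f n) →
    value (f n) ≤ᴿ fromℚ (+ n / 1000) →
    ∃[ g ] (IsGamma f n g ×
    value (fromℕ⁺ n /⁺ (fromℕ⁺ 50 *⁺ √ (f n)))
    ⊓ᴿ value ((fromℕ⁺ n *⁺ fromℕ⁺ n) /⁺ (fromℕ⁺ 2500 *⁺ (f n *⁺ f n)))
    ⊓ᴿ fromℚ (+ n / 1000)
    ≤ᴿ fromℚ (fromℕ g))
corollary1p4 f n integral f≤n/1000 = map₂ (λ {g} → map₂ (minimum-bound g)) γ-exists
  where open Threshold f n integral f≤n/1000
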